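{- An instance $J$ of Diverse Multistage Plurality Voting with diversity bound $\ell$ can be solved in $2^{O(\ell)}\cdot |J|^{O(1)}$ time.
   Context: $\mathbb{N}$ denotes the positive integers, $[n]=\{1,\dots,n\}$, and $A\Delta B$ is the symmetric difference. Diverse Multistage Plurality Voting: The input is a set $A$ of agents, a set $C$ of candidates, a sequence $(u_i)_{i=1}^{\tau}$ of voting profiles $u_i\colon A\to C\cup\{\emptyset\}$, and integers $k,x,\ell\in\mathbb{N}$. The question is whether there is a sequence $(C_1,\dots,C_\tau)$ of sets $C_i\subseteq C$ such that for all $i\in[\tau]$ it holds that $|C_i|\le k$ and $|u_i^{ -1}(C_i)|\ge x$, and for all $i\in[\tau-1]$ it holds that $|C_i\Delta C_{i+1}|\ge \ell$. Here $u_i^{ -1}(C_i)$ is the set of agents $a\in A$ with $u_i(a)\in C_i$. -}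

module Defs where

open import Data.Bool.Base using (Bool; true; false)
open import Data.Fin.Base using (Fin; toℕ)
open import Data.Fin.Subset using (Subset; outside; ∣_∣; _∪_; _─_)
open import Data.List.Base as List using (List; []; _∷_)
open import Data.Maybe.Base using (Maybe; just; nothing; maybe′)
open import Data.Nat.Base using (ℕ; suc; _+_; _≤_; NonZero)
open import Data.Nat.Binary.Base using (ℕᵇ; zero; 2[1+_]; 1+[2_]; fromℕ)
open import Data.Product.Base using (Σ-syntax; _×_)
open import Data.Vec.Base using (Vec; []; _∷_; lookup; tabulate)
open import Relation.Binary.PropositionalEquality.Core using (_≡_)

-- The finite sets A and C are taken to be Fin agents and Fin candidates;
-- `nothing` is the abstention ∅.
record Instance : Set where
  field
    agents candidates : ℕ
    τ       : ℕ
    profile : Fin τ → Fin agents → Maybe (Fin candidates)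
    k x ℓ   : ℕ
    ⦃ τ≢0 ⦄ : NonZero τ
    ⦃ k≢0 ⦄ : NonZero k
    ⦃ x≢0 ⦄ : NonZero x
    ⦃ ℓ≢0 ⦄ : NonZero ℓ

_Δ_ : ∀ {n} → Subset n → Subset n → Subset n
S Δ T = (S ─ T) ∪ (T ─ S)

preimage : ∀ {m n} → (Fin m → Maybe (Fin n)) → Subset n → Subset m
preimage u S = tabulate λ a → maybe′ (lookup S) outside (u a)

HasSolution : Instance → Set
HasSolution J =
  Σ[ S ∈ (Fin τ → Subset candidates) ]
    (∀ i → ∣ S i ∣ ≤ k × x ≤ ∣ preimage (profile i) (S i) ∣) ×
    (∀ i j → toℕ j ≡ suc (toℕ i) → ℓ ≤ ∣ S i Δ S j ∣)
  where open Instance J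

-- Model of computation: first-order, call-by-value recursive programs over
-- binary trees, in the style of N. D. Jones, "Computability and Complexity".
-- Every evaluation step costs one unit.  Steps copy only pointers and branch
-- only on the root of a tree, so with shared subtrees each one takes constant
-- time on a pointer machine.  Running times therefore agree with those of
-- Turing machines and RAMs (logarithmic cost) up to a polynomial, which
-- leaves bounds of the form 2^O(ℓ) · |J|^O(1) unaffected.

data Tree : Set where
  leaf : Tree
  node : Tree → Tree → Tree

size : Tree → ℕ
size leaf       = 1
size (node s t) = suc (size s + size t)

-- Expressions with n free variables (de Bruijn indices) that may call the
-- functions Fin N, where function f takes arity f arguments.
data Exp {N : ℕ} (arity : Fin N → ℕ) (n : ℕ) : Set where
  var  : Fin n → Exp arity n
  leaf : Exp arity n
  node : Exp arity n → Exp arity n → Exp arity n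
  case : Exp arity n → Exp arity n → Exp arity (2 + n) → Exp arity n
  bind : Exp arity n → Exp arity (1 + n) → Exp arity n
  call : (f : Fin N) → Vec (Exp arity n) (arity f) → Exp arity n

record Program : Set where
  field
    functions : ℕ
    arity     : Fin functions → ℕ
    body      : (f : Fin functions) → Exp arity (arity f)
    main      : Exp arity 1

module Semantics (P : Program) where
  open Program P

  infix 4 _⊢_⇓_⟨_⟩ _⊢*_⇓_⟨_⟩

  -- ρ ⊢ e ⇓ v ⟨ t ⟩ : in environment ρ, e evaluates to v in exactly t steps.
  data _⊢_⇓_⟨_⟩ {n : ℕ} (ρ : Vec Tree n) : Exp arity n → Tree → ℕ → Set
  data _⊢*_⇓_⟨_⟩ {n : ℕ} (ρ : Vec Tree n) :
    ∀ {m} → Vec (Exp arity n) m → Vec Tree m → ℕ → Set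

  data _⊢_⇓_⟨_⟩ {n} ρ where
    var : ∀ i → ρ ⊢ var i ⇓ lookup ρ i ⟨ 1 ⟩
    leaf : ρ ⊢ leaf ⇓ leaf ⟨ 1 ⟩
    node : ∀ {e₁ e₂ v₁ v₂ t₁ t₂} →
      ρ ⊢ e₁ ⇓ v₁ ⟨ t₁ ⟩ → ρ ⊢ e₂ ⇓ v₂ ⟨ t₂ ⟩ →
      ρ ⊢ node e₁ e₂ ⇓ node v₁ v₂ ⟨ suc (t₁ + t₂) ⟩
    case-leaf : ∀ {e e₁ e₂ v s t} →
      ρ ⊢ e ⇓ leaf ⟨ s ⟩ → ρ ⊢ e₁ ⇓ v ⟨ t ⟩ →
      ρ ⊢ case e e₁ e₂ ⇓ v ⟨ suc (s + t) ⟩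
    case-node : ∀ {e e₁ e₂ v₁ v₂ v s t} →
      ρ ⊢ e ⇓ node v₁ v₂ ⟨ s ⟩ → v₁ ∷ v₂ ∷ ρ ⊢ e₂ ⇓ v ⟨ t ⟩ →
      ρ ⊢ case e e₁ e₂ ⇓ v ⟨ suc (s + t) ⟩
    bind : ∀ {e₁ e₂ v₁ v s t} →
      ρ ⊢ e₁ ⇓ v₁ ⟨ s ⟩ → v₁ ∷ ρ ⊢ e₂ ⇓ v ⟨ t ⟩ →
      ρ ⊢ bind e₁ e₂ ⇓ v ⟨ suc (s + t) ⟩
    call : ∀ {f es vs v s t} →
      ρ ⊢* es ⇓ vs ⟨ s ⟩ → vs ⊢ body f ⇓ v ⟨ t ⟩ →
      ρ ⊢ call f es ⇓ v ⟨ suc (s + t) ⟩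

  data _⊢*_⇓_⟨_⟩ {n} ρ where
    []  : ρ ⊢* [] ⇓ [] ⟨ 0 ⟩
    _∷_ : ∀ {m e v s t} {es : Vec (Exp arity n) m} {vs} →
      ρ ⊢ e ⇓ v ⟨ s ⟩ → ρ ⊢* es ⇓ vs ⟨ t ⟩ →
      ρ ⊢* e ∷ es ⇓ v ∷ vs ⟨ s + t ⟩

_on_outputs_inTime_ : Program → Tree → Tree → ℕ → Set
P on input outputs v inTime t = input ∷ [] ⊢ Program.main P ⇓ v ⟨ t ⟩
  where open Semantics P

encodeBool : Bool → Tree
encodeBool false = leaf
encodeBool true  = node leaf leaf

encodeList : ∀ {X : Set} → (X → Tree) → List X → Tree
encodeList f []       = leaf
encodeList f (x ∷ xs) = node (f x) (encodeList f xs)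

-- Bijective base-2 digits, least significant first, so that the size of an
-- encoded number is logarithmic in the number.
encodeℕᵇ : ℕᵇ → Tree
encodeℕᵇ zero     = leaf
encodeℕᵇ 2[1+ n ] = node (encodeBool false) (encodeℕᵇ n)
encodeℕᵇ 1+[2 n ] = node (encodeBool true) (encodeℕᵇ n)

encodeℕ : ℕ → Tree
encodeℕ n = encodeℕᵇ (fromℕ n)

encodeFin : ∀ {n} → Fin n → Tree
encodeFin i = encodeℕ (toℕ i)

encodeMaybe : ∀ {X : Set} → (X → Tree) → Maybe X → Tree
encodeMaybe f nothing  = leaf
encodeMaybe f (just x) = node leaf (f x)

encodeFamily : ∀ {X : Set} {n} → (X → Tree) → (Fin n → X) → Tree
encodeFamily f g = encodeList f (List.tabulate g)

-- The sets of agents and candidates are listed element by element, hence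
-- contribute at least their cardinality to the size of the instance.
encodeSet : ℕ → Tree
encodeSet n = encodeFamily {n = n} encodeFin (λ i → i)

encode : Instance → Tree
encode J =
  node (encodeSet agents)
  (node (encodeSet candidates)
  (node (encodeFamily (encodeFamily (encodeMaybe encodeFin)) profile)
  (node (encodeℕ k)
  (node (encodeℕ x)
        (encodeℕ ℓ)))))
  where open Instance J

∥_∥ : Instance → ℕ
∥ J ∥ = size (encode J)

{-# OPTIONS --safe #-}
module Submission where

-- Fix a stage and order the candidates by decreasing number of votes, breaking
-- ties by index.  If a solution selects A at this stage, then exchanging
-- candidates of A, with the two neighbouring sets kept fixed, brings A into a form
-- that contains all candidates of rank below k - 8ℓ and none of rank k + 8ℓ or
-- more: a neighbour at distance at least ℓ + 2 tolerates any swap, and a closer one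
-- differs from A in so few candidates that a harmless swap can be found.
-- This leaves at most 2^(16ℓ) sets per stage, and a dynamic program over the stages
-- tries all of them.  (Here k and ℓ are capped at n and n + 1, respectively.)
--
-- The algorithm is written as a term of a small total language with right folds,
-- and the program is an interpreter applied to the code of that term.

-- A swap at one stage affects only the two distances to the neighbouring sets, so the stages can be
-- brought into form one after the other, front to back. Candidates may be barred from a swap by
-- each tight neighbour, at most ℓ + 1 per neighbour, and the selected set may fall short of k by as
-- many as 2ℓ + 2; together this gives 4ℓ + 4, which is at most 8ℓ because ℓ is positive. The window
-- around k thus spans 16ℓ ranks. For the running time, the interpreter has to be verified only
-- once. Since terms recurse through folds alone, their cost is a function defined by recursion on
-- the term, and it can be bounded rule by rule. Only the exponents matter in the end, so all
-- estimates are deliberately coarse. The bounds k, x and ℓ are given in binary and may be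
-- exponential in the input size, while the term calculates in unary. Capping them reconciles the
-- two.

open import Defs
open import Algebra.Properties.Semiring.Sum using ()
open import Data.Bool.Base using (Bool; true; false; _∧_; _∨_; _xor_; not; if_then_else_; T)
import Data.Bool.Properties as Bool
open import Data.Fin using (#_)
open import Data.Fin.Base using (Fin; zero; suc; toℕ)
open import Data.Fin.Patterns using (0F; 1F; 2F; 3F)
open import Data.Fin.Properties using (any?; _≟_; suc-injective; toℕ-injective; toℕ<n)
open import Data.Fin.Subset using (Subset; ∣_∣; inside; outside)
open import Data.List.Base as List using (List; []; _∷_; _++_; length; map; tabulate; allFin; filterᵇ; replicate)
open import Data.List.Membership.Propositional using (_∈_)
open import Data.List.Membership.Propositional.Properties using (∈-++⁺ˡ; ∈-++⁺ʳ; ∈-map⁺)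
open import Data.List.Properties using (length-tabulate; length-replicate)
open import Data.List.Relation.Unary.All as All using (All; []; _∷_)
open import Data.List.Relation.Unary.Any using (here; there)
open import Data.Maybe.Base using (Maybe; just; nothing; maybe′)
open import Data.Nat.Base
import Data.Nat.Binary.Base as ℕᵇ
open import Data.Nat.Binary.Base using (ℕᵇ; 2[1+_]; 1+[2_])
open import Data.Nat.Binary.Properties using (toℕ-fromℕ)
open import Data.Nat.Properties hiding (_≟_; suc-injective)
open import Data.Nat.Tactic.RingSolver using (solve-∀)
open import Data.Product.Base using (Σ-syntax; ∃-syntax; _×_; _,_; proj₁; proj₂)
open import Data.Sum.Base using (_⊎_; inj₁; inj₂)
open import Data.Unit.Base using (⊤; tt)
open import Data.Vec.Base as Vec using (Vec; []; _∷_; lookup)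
open import Data.Vec.Functional using (updateAt)
open import Data.Vec.Functional.Properties using (updateAt-minimal)
open import Data.Vec.Properties using (lookup∘tabulate)
open import Function.Base using (_∘_; id; const; case_of_)
open import Function.Bundles using (Equivalence)
open import Relation.Binary.Definitions using (tri<; tri≈; tri>)
open import Relation.Binary.PropositionalEquality
open import Relation.Nullary.Decidable using (yes; no; does; True; toWitness)
open import Relation.Nullary.Negation using (contradiction)
open import Relation.Nullary.Reflects using (Reflects; ofʸ; ofⁿ)
open Algebra.Properties.Semiring.Sum +-*-semiring using (sum; sum-cong-≗; ∑-comm; *-distribˡ-sum; sum-replicate-zero)

-- The term language and its interpreter

-- A term denotes a function on trees.  Its argument is an environment listing
-- the values of the variables: `var i` is entry i, the last argument of `case`
-- sees the two subtrees in front of the environment, that of `fold` the current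
-- element and the accumulator (a right fold), and `app e a` runs e in the
-- environment computed by a.
data Term : Set where
  var            : ℕ → Term
  env leaf       : Term
  node equal app : Term → Term → Term
  case fold      : Term → Term → Term → Term

positive : ℕ → Bool
positive zero    = false
positive (suc _) = true

look : ℕ → Tree → Tree
look i       leaf       = leaf
look zero    (node v ρ) = v
look (suc i) (node v ρ) = look i ρ

treeEq : Tree → Tree → Bool
treeEq leaf         leaf         = true
treeEq leaf         (node _ _)   = false
treeEq (node _ _)   leaf         = false
treeEq (node u₁ u₂) (node v₁ v₂) = treeEq u₁ v₁ ∧ treeEq u₂ v₂

branch : ∀ {X : Set} → Tree → X → (Tree → Tree → X) → X
branch leaf       x f = x
branch (node u v) x f = f u v

foldTree : ∀ {X : Set} → (Tree → X → X) → X → Tree → X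
foldTree f x leaf       = x
foldTree f x (node h t) = f h (foldTree f x t)

⟦_⟧ : Term → Tree → Tree
⟦ var i ⟧      ρ = look i ρ
⟦ env ⟧        ρ = ρ
⟦ leaf ⟧       ρ = leaf
⟦ node a b ⟧   ρ = node (⟦ a ⟧ ρ) (⟦ b ⟧ ρ)
⟦ equal a b ⟧  ρ = encodeBool (treeEq (⟦ a ⟧ ρ) (⟦ b ⟧ ρ))
⟦ app e a ⟧    ρ = ⟦ e ⟧ (⟦ a ⟧ ρ)
⟦ case a b c ⟧ ρ = branch (⟦ a ⟧ ρ) (⟦ b ⟧ ρ) λ u v → ⟦ c ⟧ (node u (node v ρ))
⟦ fold l z s ⟧ ρ = foldTree (λ h acc → ⟦ s ⟧ (node h (node acc ρ))) (⟦ z ⟧ ρ) (⟦ l ⟧ ρ)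

nat : ℕ → Tree
nat zero    = leaf
nat (suc n) = node leaf (nat n)

code : Term → Tree
code (var i)      = node (nat 0) (nat i)
code env          = node (nat 1) leaf
code leaf         = leaf
code (node a b)   = node (nat 2) (node (code a) (code b))
code (case a b c) = node (nat 3) (node (code a) (node (code b) (code c)))
code (fold l z s) = node (nat 4) (node (code l) (node (code z) (code s)))
code (equal a b)  = node (nat 5) (node (code a) (code b))
code (app e a)    = node (nat 6) (node (code e) (code a))

interpreterArity : Fin 4 → ℕ
interpreterArity 2F = 4
interpreterArity _  = 2

pattern RUN  = 0F
pattern LOOK = 1F
pattern LOOP = 2F
pattern EQ   = 3F

run : ∀ {n} → Exp interpreterArity n → Exp interpreterArity n → Exp interpreterArity n
run c ρ = call RUN (c ∷ ρ ∷ [])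

-- The nested `case`s count down the unary tag. Each of them pushes two variables, so at tag j the
-- payload is variable 2j + 1 and the environment variable 2j + 3. The `leaf` alternatives for
-- payloads are never reached on the code of a term.
interpreterBody : (f : Fin 4) → Exp interpreterArity (interpreterArity f)
interpreterBody RUN =
  case (var (# 0)) leaf
  (case (var (# 0)) (call LOOK (var (# 1) ∷ var (# 3) ∷ []))
  (case (var (# 1)) (var (# 5))
  (case (var (# 1))
    (case (var (# 5)) leaf (node (run (var (# 0)) (var (# 9))) (run (var (# 1)) (var (# 9)))))
  (case (var (# 1))
    (case (var (# 7)) leaf (case (var (# 1)) leaf
      (case (run (var (# 2)) (var (# 13))) (run (var (# 0)) (var (# 13)))
        (run (var (# 3)) (node (var (# 0)) (node (var (# 1)) (var (# 15))))))))
  (case (var (# 1))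
    (case (var (# 9)) leaf (case (var (# 1)) leaf
      (call LOOP (run (var (# 2)) (var (# 15)) ∷ run (var (# 0)) (var (# 15))
                  ∷ var (# 1) ∷ var (# 15) ∷ []))))
  (case (var (# 1))
    (case (var (# 11)) leaf
      (call EQ (run (var (# 0)) (var (# 15)) ∷ run (var (# 1)) (var (# 15)) ∷ [])))
    (case (var (# 13)) leaf
      (run (var (# 0)) (run (var (# 1)) (var (# 17)))))))))))
interpreterBody LOOK =
  case (var (# 1)) leaf (case (var (# 2)) (var (# 0)) (call LOOK (var (# 1) ∷ var (# 3) ∷ [])))
interpreterBody LOOP =
  case (var (# 0)) (var (# 1))
    (run (var (# 4)) (node (var (# 0)) (node
      (call LOOP (var (# 1) ∷ var (# 3) ∷ var (# 4) ∷ var (# 5) ∷ [])) (var (# 5)))))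
interpreterBody EQ =
  case (var (# 0)) (case (var (# 1)) (node leaf leaf) leaf)
    (case (var (# 3)) leaf
      (case (call EQ (var (# 2) ∷ var (# 0) ∷ [])) leaf
        (call EQ (var (# 5) ∷ var (# 3) ∷ []))))

literal : ∀ {n} → Tree → Exp interpreterArity n
literal leaf       = leaf
literal (node s t) = node (literal s) (literal t)

interpret : Term → Program
interpret e = record
  { functions = 4
  ; arity     = interpreterArity
  ; body      = interpreterBody
  ; main      = run (literal (code e)) (var (# 0))
  }

literalCost : Tree → ℕ
literalCost leaf       = 1
literalCost (node s t) = suc (literalCost s + literalCost t)

-- The constants below are the exact numbers of steps the interpreter takes.
lookCost : ℕ → Tree → ℕ
lookCost i       leaf       = 3
lookCost zero    (node v ρ) = 5
lookCost (suc i) (node v ρ) = 7 + lookCost i ρ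

eqCost : Tree → Tree → ℕ
eqCost leaf         leaf         = 7
eqCost leaf         (node _ _)   = 5
eqCost (node _ _)   leaf         = 5
eqCost (node u₁ u₂) (node v₁ v₂) with treeEq u₁ v₁
... | true  = 8 + (eqCost u₁ v₁ + (3 + eqCost u₂ v₂))
... | false = 8 + (eqCost u₁ v₁ + 1)

loopCost : (Tree → Tree → Tree) → (Tree → Tree → ℕ) → Tree → Tree → ℕ
loopCost f c z leaf       = 3
loopCost f c z (node h t) = 12 + (((loopCost f c z t + 1) + 0) + c h (foldTree f z t))

cost : Term → Tree → ℕ
cost (var i)      ρ = 7 + lookCost i ρ
cost env          ρ = 7
cost leaf         ρ = 3
cost (node a b)   ρ = 11 + ((3 + cost a ρ) + (3 + cost b ρ))
cost (equal a b)  ρ = 17 + (((3 + cost a ρ) + ((3 + cost b ρ) + 0)) + eqCost (⟦ a ⟧ ρ) (⟦ b ⟧ ρ))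
cost (app e a)    ρ = 18 + (((3 + cost a ρ) + 0) + cost e (⟦ a ⟧ ρ))
cost (case a b c) ρ = 15 + ((3 + cost a ρ) + branch (⟦ a ⟧ ρ) (3 + cost b ρ)
                             λ u v → 7 + cost c (node u (node v ρ)))
cost (fold l z s) ρ = 17 + (((3 + cost l ρ) + ((3 + cost z ρ) + 2))
                             + loopCost (λ h acc → ⟦ s ⟧ (node h (node acc ρ)))
                                        (λ h acc → cost s (node h (node acc ρ))) (⟦ z ⟧ ρ) (⟦ l ⟧ ρ))

-- Correctness and exact step count of the interpreter.

module _ (main : Term) where
  open Semantics (interpret main)

  look-correct : ∀ i ρ → nat i ∷ ρ ∷ [] ⊢ interpreterBody LOOK ⇓ look i ρ ⟨ lookCost i ρ ⟩
  look-correct i       leaf       = case-leaf (var _) leaf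
  look-correct zero    (node v ρ) = case-node (var _) (case-leaf (var _) (var _))
  look-correct (suc i) (node v ρ) =
    case-node (var _) (case-node (var _) (call (var _ ∷ var _ ∷ []) (look-correct i ρ)))

  eq-correct : ∀ u v → u ∷ v ∷ [] ⊢ interpreterBody EQ ⇓ encodeBool (treeEq u v) ⟨ eqCost u v ⟩
  eq-correct leaf leaf = case-leaf (var _) (case-leaf (var _) (node leaf leaf))
  eq-correct leaf (node _ _) = case-leaf (var _) (case-node (var _) leaf)
  eq-correct (node _ _) leaf = case-node (var _) (case-leaf (var _) leaf)
  eq-correct (node u₁ u₂) (node v₁ v₂) with treeEq u₁ v₁ | eq-correct u₁ v₁
  ... | true  | ih = case-node (var _) (case-node (var _)
                       (case-node (call (var _ ∷ var _ ∷ []) ih)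
                         (call (var _ ∷ var _ ∷ []) (eq-correct u₂ v₂))))
  ... | false | ih = case-node (var _) (case-node (var _)
                       (case-leaf (call (var _ ∷ var _ ∷ []) ih) leaf))

  run-correct : ∀ e ρ → code e ∷ ρ ∷ [] ⊢ interpreterBody RUN ⇓ ⟦ e ⟧ ρ ⟨ cost e ρ ⟩
  loop-correct : ∀ s ρ z l →
    l ∷ z ∷ code s ∷ ρ ∷ [] ⊢ interpreterBody LOOP
      ⇓ foldTree (λ h acc → ⟦ s ⟧ (node h (node acc ρ))) z l
      ⟨ loopCost (λ h acc → ⟦ s ⟧ (node h (node acc ρ))) (λ h acc → cost s (node h (node acc ρ))) z l ⟩

  run-correct (var i) ρ = case-node (var _) (case-leaf (var _) (call (var _ ∷ var _ ∷ []) (look-correct i ρ)))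
  run-correct env ρ = case-node (var _) (case-node (var _) (case-leaf (var _) (var _)))
  run-correct leaf ρ = case-leaf (var _) leaf
  run-correct (node a b) ρ =
    case-node (var _) (case-node (var _) (case-node (var _) (case-leaf (var _)
      (case-node (var _)
        (node (call (var _ ∷ var _ ∷ []) (run-correct a ρ))
              (call (var _ ∷ var _ ∷ []) (run-correct b ρ)))))))
  run-correct (case a b c) ρ with ⟦ a ⟧ ρ | run-correct a ρ
  ... | leaf | ih =
    case-node (var _) (case-node (var _) (case-node (var _) (case-node (var _) (case-leaf (var _)
      (case-node (var _) (case-node (var _)
        (case-leaf (call (var _ ∷ var _ ∷ []) ih)
          (call (var _ ∷ var _ ∷ []) (run-correct b ρ)))))))))
  ... | node u v | ih =
    case-node (var _) (case-node (var _) (case-node (var _) (case-node (var _) (case-leaf (var _)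
      (case-node (var _) (case-node (var _)
        (case-node (call (var _ ∷ var _ ∷ []) ih)
          (call (var _ ∷ node (var _) (node (var _) (var _)) ∷ [])
            (run-correct c (node u (node v ρ)))))))))))
  run-correct (fold l z s) ρ =
    case-node (var _) (case-node (var _) (case-node (var _) (case-node (var _) (case-node (var _)
      (case-leaf (var _) (case-node (var _) (case-node (var _)
        (call (call (var _ ∷ var _ ∷ []) (run-correct l ρ)
               ∷ call (var _ ∷ var _ ∷ []) (run-correct z ρ) ∷ var _ ∷ var _ ∷ [])
          (loop-correct s ρ (⟦ z ⟧ ρ) (⟦ l ⟧ ρ))))))))))
  run-correct (equal a b) ρ =
    case-node (var _) (case-node (var _) (case-node (var _) (case-node (var _) (case-node (var _)
      (case-node (var _) (case-leaf (var _) (case-node (var _)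
        (call (call (var _ ∷ var _ ∷ []) (run-correct a ρ)
               ∷ call (var _ ∷ var _ ∷ []) (run-correct b ρ) ∷ [])
          (eq-correct (⟦ a ⟧ ρ) (⟦ b ⟧ ρ))))))))))
  run-correct (app e a) ρ =
    case-node (var _) (case-node (var _) (case-node (var _) (case-node (var _) (case-node (var _)
      (case-node (var _) (case-node (var _) (case-node (var _)
        (call (var _ ∷ call (var _ ∷ var _ ∷ []) (run-correct a ρ) ∷ [])
          (run-correct e (⟦ a ⟧ ρ))))))))))
  loop-correct s ρ z leaf = case-leaf (var _) (var _)
  loop-correct s ρ z (node h t) =
    case-node (var _)
      (call (var _ ∷ node (var _) (node (call (var _ ∷ var _ ∷ var _ ∷ var _ ∷ []) (loop-correct s ρ z t)) (var _)) ∷ [])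
        (run-correct s (node h (node _ ρ))))

  literal-correct : ∀ {n} {σ : Vec Tree n} u → σ ⊢ literal u ⇓ u ⟨ literalCost u ⟩
  literal-correct leaf       = leaf
  literal-correct (node s t) = node (literal-correct s) (literal-correct t)

-- The exchange argument

ι : Bool → ℕ
ι false = 0
ι true  = 1

total : ∀ {n} → (Fin n → ℕ) → (Fin n → Bool) → ℕ
total f A = sum λ c → ι (A c) * f c

card : ∀ {n} → (Fin n → Bool) → ℕ
card A = sum (ι ∘ A)

dist : ∀ {n} → (Fin n → Bool) → (Fin n → Bool) → ℕ
dist A X = card λ c → A c xor X c

put : ∀ {n} → (Fin n → Bool) → Fin n → Bool → Fin n → Bool
put A d b = updateAt A d (const b)

<ᵇ-true : ∀ {a b} → (a <ᵇ b) ≡ true → a < b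
<ᵇ-true {a} {b} p = <ᵇ⇒< a b (subst T (sym p) _)

true-<ᵇ : ∀ {a b} → a < b → (a <ᵇ b) ≡ true
true-<ᵇ p = Equivalence.to Bool.T-≡ (<⇒<ᵇ p)

<ᵇ-false : ∀ {a b} → (a <ᵇ b) ≡ false → b ≤ a
<ᵇ-false {a} {b} p = ≮⇒≥ λ q → case trans (sym p) (true-<ᵇ q) of λ ()

sum-mono-≤ : ∀ {n} {f g : Fin n → ℕ} → (∀ c → f c ≤ g c) → sum f ≤ sum g
sum-mono-≤ {zero}  p = z≤n
sum-mono-≤ {suc n} p = +-mono-≤ (p zero) (sum-mono-≤ (p ∘ suc))

card-⊆ : ∀ {n} {P Q : Fin n → Bool} → (∀ c → P c ≡ true → Q c ≡ true) → card P ≤ card Q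
card-⊆ {P = P} {Q} p = sum-mono-≤ λ c → ι-mono (P c) (Q c) (p c)
  where
  ι-mono : ∀ a b → (a ≡ true → b ≡ true) → ι a ≤ ι b
  ι-mono false b     p = z≤n
  ι-mono true  true  p = ≤-refl
  ι-mono true  false p = case p refl of λ ()

card-∨ : ∀ {n} (P Q : Fin n → Bool) → card (λ c → P c ∨ Q c) ≤ card P + card Q
card-∨ {zero}  P Q = z≤n
card-∨ {suc n} P Q with P zero | Q zero | card-∨ (P ∘ suc) (Q ∘ suc)
... | false | false | ih = ih
... | false | true  | ih = ≤-trans (s≤s ih) (≤-reflexive (sym (+-suc _ _)))
... | true  | false | ih = s≤s ih
... | true  | true  | ih = s≤s (≤-trans ih (+-monoʳ-≤ _ (n≤1+n _)))

card-false : ∀ {n} → card {n} (λ _ → false) ≡ 0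
card-false {n} = sum-replicate-zero n

card-true : ∀ {n} → card {n} (λ _ → true) ≡ n
card-true {zero}  = refl
card-true {suc n} = cong suc card-true

exists-outside : ∀ {n} (P Q : Fin n → Bool) → card Q < card P → ∃[ c ] P c ≡ true × Q c ≡ false
exists-outside {n} P Q lt with any? (λ c → (P c ∧ not (Q c)) Bool.≟ true)
... | yes (c , p) with P c in eq₁ | Q c in eq₂
...   | true | false = c , eq₁ , eq₂
exists-outside {n} P Q lt | no ¬p = contradiction lt (≤⇒≯ (card-⊆ λ c → sub c (P c) (Q c) refl refl))
  where
  sub : ∀ c a b → P c ≡ a → Q c ≡ b → a ≡ true → b ≡ true
  sub c true true  _ _ _ = refl
  sub c true false p q _ = contradiction (c , cong₂ (λ a b → a ∧ not b) p q) ¬p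

exists-outside₃ : ∀ {n} (P Q R S : Fin n → Bool) → card Q + (card R + card S) < card P →
  ∃[ c ] P c ≡ true × Q c ≡ false × R c ≡ false × S c ≡ false
exists-outside₃ P Q R S lt =
  let c , p , q = exists-outside P (λ c → Q c ∨ (R c ∨ S c))
        (≤-<-trans (≤-trans (card-∨ Q _) (+-monoʳ-≤ (card Q) (card-∨ R S))) lt)
      q₁ , q₂₃ = split (Q c) q
      q₂ , q₃  = split (R c) q₂₃
  in c , p , q₁ , q₂ , q₃
  where
  split : ∀ a {b} → a ∨ b ≡ false → a ≡ false × b ≡ false
  split false p = refl , p

-- Only the summand at `d` changes. The replaced summands are added crosswise to avoid subtraction;
-- weights, cardinalities and distances are all instances of `h`.
sum-put : ∀ {n} (h : Fin n → Bool → ℕ) (A : Fin n → Bool) d b →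
  sum (λ c → h c (put A d b c)) + h d (A d) ≡ sum (λ c → h c (A c)) + h d b
sum-put h A zero b = lemma (h zero b) (h zero (A zero)) _
  where
  lemma : ∀ x y s → (x + s) + y ≡ (y + s) + x
  lemma = solve-∀
sum-put h A (suc d) b = begin
  (h zero (A zero) + sum (λ c → h (suc c) (put (A ∘ suc) d b c))) + h (suc d) (A (suc d))
    ≡⟨ +-assoc (h zero (A zero)) _ _ ⟩
  h zero (A zero) + (sum (λ c → h (suc c) (put (A ∘ suc) d b c)) + h (suc d) (A (suc d)))
    ≡⟨ cong (h zero (A zero) +_) (sum-put (h ∘ suc) (A ∘ suc) d b) ⟩
  h zero (A zero) + (sum (λ c → h (suc c) (A (suc c))) + h (suc d) b)
    ≡⟨ +-assoc (h zero (A zero)) _ _ ⟨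
  (h zero (A zero) + sum (λ c → h (suc c) (A (suc c)))) + h (suc d) b ∎
  where open ≡-Reasoning

total-add : ∀ {n} (f : Fin n → ℕ) A {d} → A d ≡ false → total f (put A d true) ≡ total f A + f d
total-add f A {d} p with q ← sum-put (λ c b → ι b * f c) A d true rewrite p =
  trans (sym (+-identityʳ _)) (trans q (cong (total f A +_) (+-identityʳ (f d))))

total-remove : ∀ {n} (f : Fin n → ℕ) A {c} → A c ≡ true → total f (put A c false) + f c ≡ total f A
total-remove f A {c} p with q ← sum-put (λ c b → ι b * f c) A c false rewrite p =
  trans (cong (total f (put A c false) +_) (sym (+-identityʳ (f c)))) (trans q (+-identityʳ _))

card≡total : ∀ {n} (A : Fin n → Bool) → card A ≡ total (λ _ → 1) A
card≡total A = sum-cong-≗ λ c → sym (*-identityʳ (ι (A c)))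

dist-add : ∀ {n} (A X : Fin n → Bool) {d} → A d ≡ false →
  dist (put A d true) X + ι (X d) ≡ dist A X + ι (not (X d))
dist-add A X {d} p with q ← sum-put (λ c b → ι (b xor X c)) A d true rewrite p = q

dist-remove : ∀ {n} (A X : Fin n → Bool) {c} → A c ≡ true →
  dist (put A c false) X + ι (not (X c)) ≡ dist A X + ι (X c)
dist-remove A X {c} p with q ← sum-put (λ c b → ι (b xor X c)) A c false rewrite p = q

ι≤1 : ∀ b → ι b ≤ 1
ι≤1 false = z≤n
ι≤1 true  = ≤-refl

swap : ∀ {n} → (Fin n → Bool) → Fin n → Fin n → Fin n → Bool
swap A c d = put (put A c false) d true

module _ {n} (A : Fin n → Bool) {c d} (A-c : A c ≡ true) (A-d : A d ≡ false) where

  private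
    A₁ = put A c false
    A₁-d : A₁ d ≡ false
    A₁-d = trans (updateAt-minimal d c A λ { refl → case trans (sym A-c) A-d of λ () }) A-d

  total-swap : ∀ f → total f (swap A c d) + f c ≡ total f A + f d
  total-swap f = begin
    total f (swap A c d) + f c   ≡⟨ cong (_+ f c) (total-add f A₁ A₁-d) ⟩
    total f A₁ + f d + f c       ≡⟨ lemma (total f A₁) (f d) (f c) ⟩
    total f A₁ + f c + f d       ≡⟨ cong (_+ f d) (total-remove f A A-c) ⟩
    total f A + f d              ∎
    where
    open ≡-Reasoning
    lemma : ∀ a b c → a + b + c ≡ a + c + b
    lemma = solve-∀

  module _ (X : Fin n → Bool) where

    private
      equation : dist (swap A c d) X + (ι (X d) + ι (not (X c))) ≡ dist A X + (ι (X c) + ι (not (X d)))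
      equation = begin
        dist (swap A c d) X + (ι (X d) + ι (not (X c)))  ≡⟨ +-assoc (dist (swap A c d) X) _ _ ⟨
        dist (swap A c d) X + ι (X d) + ι (not (X c))    ≡⟨ cong (_+ ι (not (X c))) (dist-add A₁ X A₁-d) ⟩
        dist A₁ X + ι (not (X d)) + ι (not (X c))        ≡⟨ lemma (dist A₁ X) _ _ ⟩
        dist A₁ X + ι (not (X c)) + ι (not (X d))        ≡⟨ cong (_+ ι (not (X d))) (dist-remove A X A-c) ⟩
        dist A X + ι (X c) + ι (not (X d))               ≡⟨ +-assoc (dist A X) _ _ ⟩
        dist A X + (ι (X c) + ι (not (X d)))             ∎
        where
        open ≡-Reasoning
        lemma : ∀ a b c → a + b + c ≡ a + c + b
        lemma = solve-∀

    dist-swap-slack : dist A X ≤ dist (swap A c d) X + 2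
    dist-swap-slack = ≤-trans (m≤m+n (dist A X) _) (≤-trans (≤-reflexive (sym equation))
      (+-monoʳ-≤ (dist (swap A c d) X) (+-mono-≤ (ι≤1 (X d)) (ι≤1 (not (X c))))))

    -- One favourable half suffices: it raises the distance by 1, and the other half lowers it by at
    -- most 1.
    dist-swap : X c ≡ true ⊎ X d ≡ false → dist A X ≤ dist (swap A c d) X
    dist-swap p = +-cancelʳ-≤ (ι (X d) + ι (not (X c))) _ _
      (≤-trans (+-monoʳ-≤ (dist A X) (smaller (X c) (X d) p)) (≤-reflexive (sym equation)))
      where
      smaller : ∀ x y → x ≡ true ⊎ y ≡ false → ι y + ι (not x) ≤ ι x + ι (not y)
      smaller true  y     _         = ≤-trans (≤-reflexive (+-identityʳ _)) (≤-trans (ι≤1 y) (m≤m+n 1 _))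
      smaller false false _         = ≤-refl
      smaller false true  (inj₁ ())
      smaller false true  (inj₂ ())

dist-add-slack : ∀ {n} (A X : Fin n → Bool) {d} → A d ≡ false → dist A X ≤ dist (put A d true) X + 2
dist-add-slack A X {d} p = ≤-trans (m≤m+n _ _) (≤-trans (≤-reflexive (sym (dist-add A X p)))
  -- A single insertion costs at most 1; the estimate is relaxed to 2, the slack that `loose`
  -- expects.
  (+-monoʳ-≤ (dist (put A d true) X) (≤-trans (ι≤1 (X d)) (n≤1+n 1))))

dist-add-outside : ∀ {n} (A X : Fin n → Bool) {d} → A d ≡ false → X d ≡ false → dist A X ≤ dist (put A d true) X
dist-add-outside A X p q with r ← dist-add A X p rewrite q =
  ≤-trans (m≤m+n (dist A X) 1) (≤-reflexive (trans (sym r) (+-identityʳ _)))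

rank : ∀ {n} → (Fin n → ℕ) → Fin n → ℕ
rank key c = card λ d → key c <ᵇ key d

module Window {n} (key : Fin n → ℕ) (k W : ℕ) where

  low high : Fin n → Bool
  low  c = (rank key c + W) <ᵇ k
  -- The successor turns the strict test into k + W ≤ rank.
  high c = (k + W) <ᵇ suc (rank key c)

  -- The branching is that of the enumeration `family`, so that a set without misfits can be traced
  -- through it.
  misfit : (Fin n → Bool) → Fin n → Bool
  misfit A c = if low c then not (A c) else (high c ∧ A c)

module Exchange {n} (w key : Fin n → ℕ)
  (key-injective : ∀ {c d} → key c ≡ key d → c ≡ d)
  (key-positive : ∀ c → 0 < key c)
  (w-mono : ∀ {c d} → key c < key d → w c ≤ w d)
  (k x ℓ W : ℕ) (k≤n : k ≤ n) (W-large : 4 * ℓ + 4 ≤ W) where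

  open Window key k W

  Choice : Set
  Choice = Fin n → Bool

  -- A swap changes a distance by at most 2, so only tight neighbours restrict it;
  -- for these, A and X differ in at most ℓ + 1 candidates.
  tight : ℕ → Choice → Choice → Bool
  tight t X A = dist A X <ᵇ t + 2

  leaves enters : ℕ → Choice → Choice → Choice
  leaves t X A c = tight t X A ∧ (A c ∧ not (X c))
  enters t X A c = tight t X A ∧ (not (A c) ∧ X c)

  card-tight : ∀ t X A (p : Choice) → (∀ c → p c ≡ true → A c xor X c ≡ true) → t ≤ ℓ →
    card (λ c → tight t X A ∧ p c) ≤ suc ℓ
  card-tight t X A p sub t≤ℓ with dist A X <ᵇ t + 2 in eq
  ... | false = ≤-trans (≤-reflexive (card-false {n})) z≤n
  ... | true  = ≤-trans (card-⊆ sub)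
    (≤-trans (≤-pred (subst (dist A X <_) (+-comm t 2) (<ᵇ-true {dist A X} eq))) (s≤s t≤ℓ))

  card-leaves : ∀ t X A → t ≤ ℓ → card (leaves t X A) ≤ suc ℓ
  card-leaves t X A = card-tight t X A _ λ c → sub (A c) (X c)
    where
    sub : ∀ a x → a ∧ not x ≡ true → a xor x ≡ true
    sub true false _ = refl

  card-enters : ∀ t X A → t ≤ ℓ → card (enters t X A) ≤ suc ℓ
  card-enters t X A = card-tight t X A _ λ c → sub (A c) (X c)
    where
    sub : ∀ a x → not a ∧ x ≡ true → a xor x ≡ true
    sub false true _ = refl

  loose : ∀ t X A → tight t X A ≡ false → ∀ {s} → dist A X ≤ s + 2 → t ≤ s
  loose t X A eq p = +-cancelʳ-≤ 2 t _ (≤-trans (<ᵇ-false {dist A X} eq) p)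

  keep-swap : ∀ t X A {c d} → A c ≡ true → A d ≡ false → t ≤ dist A X →
    (tight t X A ≡ true → X c ≡ true ⊎ X d ≡ false) → t ≤ dist (swap A c d) X
  keep-swap t X A A-c A-d p q with tight t X A in eq
  ... | false = loose t X A eq (dist-swap-slack A A-c A-d X)
  ... | true  = ≤-trans p (dist-swap A A-c A-d X (q refl))

  keep-swap-leaves : ∀ t X A {c d} → A c ≡ true → A d ≡ false → t ≤ dist A X →
    leaves t X A c ≡ false → t ≤ dist (swap A c d) X
  keep-swap-leaves t X A {c} {d} A-c A-d p q = keep-swap t X A A-c A-d p
    λ r → inj₁ (get (X c) (trans (sym (cong₂ (λ a b → a ∧ (b ∧ not (X c))) r A-c)) q))
    where
    get : ∀ b → not b ≡ false → b ≡ true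
    get true _ = refl

  keep-swap-enters : ∀ t X A {c d} → A c ≡ true → A d ≡ false → t ≤ dist A X →
    enters t X A d ≡ false → t ≤ dist (swap A c d) X
  keep-swap-enters t X A {c} {d} A-c A-d p q = keep-swap t X A A-c A-d p
    λ r → inj₂ (trans (sym (cong₂ (λ a b → a ∧ (not b ∧ X d)) r A-d)) q)

  keep-add : ∀ t X A {d} → A d ≡ false → t ≤ dist A X → enters t X A d ≡ false → t ≤ dist (put A d true) X
  keep-add t X A {d} A-d p q with tight t X A in eq
  ... | false = loose t X A eq (dist-add-slack A X A-d)
  ... | true  = ≤-trans p (dist-add-outside A X A-d (trans (sym (cong (λ b → not b ∧ X d) A-d)) q))

  -- The neighbouring stages select X₁ and X₂; a missing neighbour is expressed
  -- by the threshold 0.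
  module _ (t₁ : ℕ) (X₁ : Choice) (t₁≤ℓ : t₁ ≤ ℓ) (t₂ : ℕ) (X₂ : Choice) (t₂≤ℓ : t₂ ≤ ℓ) where

    record Valid (A : Choice) : Set where
      constructor valid
      field
        card≤ : card A ≤ k
        x≤    : x ≤ total w A
        dist₁ : t₁ ≤ dist A X₁
        dist₂ : t₂ ≤ dist A X₂

    Better : Choice → Set
    Better A = ∃[ B ] Valid B × total key A < total key B

    -- A swap preserves the cardinality, and it loses no votes because a larger key never means
    -- fewer votes. Only the two distances depend on the choice of `c` and `d`.
    exchange : ∀ {A c d} → Valid A → A c ≡ true → A d ≡ false → key c < key d →
      t₁ ≤ dist (swap A c d) X₁ → t₂ ≤ dist (swap A c d) X₂ → Better A
    exchange {A} {c} {d} (valid card≤ x≤ _ _) A-c A-d lt p₁ p₂ = swap A c d , valid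
      (≤-trans (≤-reflexive (trans (card≡total (swap A c d))
        (trans (+-cancelʳ-≡ 1 _ _ (total-swap A A-c A-d (λ _ → 1))) (sym (card≡total A))))) card≤)
      (≤-trans x≤ (+-cancelʳ-≤ (w c) _ _ (≤-trans (+-monoʳ-≤ (total w A) (w-mono lt))
        (≤-reflexive (sym (total-swap A A-c A-d w))))))
      p₁ p₂ ,
      +-cancelʳ-< (key c) _ _ (<-≤-trans (+-monoʳ-< (total key A) lt) (≤-reflexive (sym (total-swap A A-c A-d key))))

    -- Together, A and the at most 2ℓ + 2 candidates whose insertion a tight neighbour forbids
    -- number fewer than k ≤ n, so some candidate is left to be inserted.
    add-new : ∀ {A} → Valid A → card A + 2 * suc ℓ < k → Better A
    add-new {A} (valid card≤ x≤ p₁ p₂) small =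
      let c , _ , A-c , e₁ , e₂ = exists-outside₃ (λ _ → true) A (enters t₁ X₁ A) (enters t₂ X₂ A)
            (≤-<-trans (+-monoʳ-≤ (card A) (+-mono-≤ (card-enters t₁ X₁ A t₁≤ℓ)
                (≤-trans (card-enters t₂ X₂ A t₂≤ℓ) (m≤m+n (suc ℓ) 0))))
              (<-≤-trans small (≤-trans k≤n (≤-reflexive (sym (card-true {n}))))))
      in put A c true , valid
        (≤-trans (≤-reflexive (trans (card≡total (put A c true))
            (trans (total-add (λ _ → 1) A A-c) (cong (_+ 1) (sym (card≡total A))))))
          (≤-trans (+-monoʳ-≤ (card A) (s≤s z≤n)) (<⇒≤ small)))
        (≤-trans x≤ (≤-trans (m≤m+n _ _) (≤-reflexive (sym (total-add w A A-c)))))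
        (keep-add t₁ X₁ A A-c p₁ e₁) (keep-add t₂ X₂ A A-c p₂ e₂) ,
        <-≤-trans (m<m+n (total key A) (key-positive c)) (≤-reflexive (sym (total-add key A A-c)))

    -- Fewer than k - (4ℓ + 4) candidates beat `d`, and A has at least k - (2ℓ + 2) elements. Even
    -- after setting aside the 2ℓ + 2 elements that tight neighbours may hold back, A contains one
    -- that does not beat `d`; it makes way for `d`.
    add-low : ∀ {A d} → Valid A → k ≤ card A + 2 * suc ℓ → low d ≡ true → A d ≡ false → Better A
    add-low {A} {d} v@(valid _ _ p₁ p₂) large low-d A-d =
      let c , A-c , above , l₁ , l₂ = exists-outside₃ A (λ c → key d <ᵇ key c) (leaves t₁ X₁ A) (leaves t₂ X₂ A)
            (≤-<-trans (+-monoʳ-≤ (rank key d) (+-mono-≤ (card-leaves t₁ X₁ A t₁≤ℓ) (card-leaves t₂ X₂ A t₂≤ℓ))) enough)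
          c≢d : key c ≢ key d
          c≢d = λ eq → case trans (sym A-c) (trans (cong A (key-injective eq)) A-d) of λ ()
      in exchange v A-c A-d (≤∧≢⇒< (<ᵇ-false {key d} above) c≢d)
           (keep-swap-leaves t₁ X₁ A A-c A-d p₁ l₁) (keep-swap-leaves t₂ X₂ A A-c A-d p₂ l₂)
      where
      open ≤-Reasoning
      lemma : ∀ r l → suc (r + (suc l + suc l)) + 2 * suc l ≡ suc (r + (4 * l + 4))
      lemma = solve-∀
      enough : rank key d + (suc ℓ + suc ℓ) < card A
      enough = +-cancelʳ-≤ (2 * suc ℓ) _ _ (begin
        suc (rank key d + (suc ℓ + suc ℓ)) + 2 * suc ℓ ≡⟨ lemma (rank key d) ℓ ⟩
        suc (rank key d + (4 * ℓ + 4))                 ≤⟨ s≤s (+-monoʳ-≤ (rank key d) W-large) ⟩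
        suc (rank key d + W)                           ≤⟨ <ᵇ-true {rank key d + W} low-d ⟩
        k                                              ≤⟨ large ⟩
        card A + 2 * suc ℓ                             ∎)

    -- At least k + 4ℓ + 4 candidates beat `c`. At most k of them lie in A and at most 2ℓ + 2 are
    -- barred from entering by tight neighbours, so one of the others can replace `c`.
    remove-high : ∀ {A c} → Valid A → high c ≡ true → A c ≡ true → Better A
    remove-high {A} {c} v@(valid card≤ _ p₁ p₂) high-c A-c =
      let d , above , A-d , e₁ , e₂ = exists-outside₃ (λ d → key c <ᵇ key d) A (enters t₁ X₁ A) (enters t₂ X₂ A) enough
      in exchange v A-c A-d (<ᵇ-true {key c} above)
           (keep-swap-enters t₁ X₁ A A-c A-d p₁ e₁) (keep-swap-enters t₂ X₂ A A-c A-d p₂ e₂)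
      where
      open ≤-Reasoning
      lemma : ∀ l → suc (suc l + suc l) + (2 * l + 1) ≡ 4 * l + 4
      lemma = solve-∀
      enough : card A + (card (enters t₁ X₁ A) + card (enters t₂ X₂ A)) < rank key c
      enough = begin-strict
        card A + (card (enters t₁ X₁ A) + card (enters t₂ X₂ A))
          ≤⟨ +-mono-≤ card≤ (+-mono-≤ (card-enters t₁ X₁ A t₁≤ℓ) (card-enters t₂ X₂ A t₂≤ℓ)) ⟩
        k + (suc ℓ + suc ℓ) <⟨ +-monoʳ-< k (≤-trans (m≤m+n _ (2 * ℓ + 1)) (≤-reflexive (lemma ℓ))) ⟩
        k + (4 * ℓ + 4)     ≤⟨ +-monoʳ-≤ k W-large ⟩
        k + W               ≤⟨ ≤-pred (<ᵇ-true {k + W} high-c) ⟩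
        rank key c          ∎

    improve : ∀ {A c} → Valid A → misfit A c ≡ true → Better A
    -- A set far below the budget is enlarged first, whatever the misfit is: `add-low` relies on A
    -- being nearly full. The total key grows in this case too, as keys are positive.
    improve {A} {c} v m with card A + 2 * suc ℓ <? k
    ... | yes small = add-new v small
    ... | no ¬small with low c in low-c | A c in A-c | high c in high-c
    ...   | true  | false | _    = add-low v (≮⇒≥ ¬small) low-c A-c
    ...   | false | true  | true = remove-high v high-c A-c
    improve {A} {c} v () | no _ | false | false | true
    improve {A} {c} v () | no _ | false | false | false

    -- Every improvement raises the total key, which is bounded.
    settle : ∀ fuel {A} → Valid A → total key (λ _ → true) < total key A + fuel →
      ∃[ B ] Valid B × (∀ c → misfit B c ≡ false)
    settle fuel {A} v lt with any? (λ c → misfit A c Bool.≟ true)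
    ... | no ¬m = A , v , λ c → Bool.¬-not (λ m → ¬m (c , m))
    settle zero {A} v lt | yes _ = contradiction
      (<-≤-trans lt (≤-trans (≤-reflexive (+-identityʳ _)) (sum-mono-≤ λ c → *-monoˡ-≤ (key c) (ι≤1 (A c))))) (<-irrefl refl)
    settle (suc fuel) {A} v lt | yes (c , m) =
      let B , v′ , more = improve v m
      in settle fuel v′ (≤-trans lt (≤-trans (≤-reflexive (+-suc (total key A) fuel)) (+-monoˡ-≤ fuel more)))

    settled : ∀ {A} → Valid A → ∃[ B ] Valid B × (∀ c → misfit B c ≡ false)
    settled {A} v = settle (suc (total key (λ _ → true))) v (m≤n⇒m≤o+n (total key A) ≤-refl)

-- Ranks and the number of candidates inside the window.

card-single : ∀ {n} {f : Fin n → ℕ} → (∀ {c d} → f c ≡ f d → c ≡ d) → ∀ v → card (λ c → f c ≡ᵇ v) ≤ 1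
card-single {zero}          inj v = z≤n
card-single {suc n} {f = f} inj v with f zero ≡ᵇ v in eq
... | false = card-single (λ p → suc-injective (inj p)) v
... | true  = s≤s (≤-trans (card-⊆ none) (≤-reflexive (card-false {n})))
  where
  none : ∀ c → (f (suc c) ≡ᵇ v) ≡ true → false ≡ true
  none c p = case inj (trans (≡ᵇ⇒≡ (f (suc c)) v (subst T (sym p) _)) (sym (≡ᵇ⇒≡ (f zero) v (subst T (sym eq) _)))) of λ ()

-- Induction on the length of the interval: by injectivity the topmost value is taken at most once.
card-interval : ∀ {n} {f : Fin n → ℕ} → (∀ {c d} → f c ≡ f d → c ≡ d) → ∀ a b (P : Fin n → Bool) →
  (∀ c → P c ≡ true → a ≤ f c × f c < a + b) → card P ≤ b
card-interval {n} {f} inj a zero P bounds = ≤-trans (card-⊆ none) (≤-reflexive (card-false {n}))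
  where
  none : ∀ c → P c ≡ true → false ≡ true
  none c p = contradiction (subst (f c <_) (+-identityʳ a) (proj₂ (bounds c p))) (≤⇒≯ (proj₁ (bounds c p)))
card-interval {n} {f} inj a (suc b) P bounds = begin
  card P ≤⟨ card-⊆ cover ⟩
  card (λ c → last c ∨ rest c) ≤⟨ card-∨ last rest ⟩
  card last + card rest ≤⟨ +-mono-≤ (card-single inj (a + b)) (card-interval inj a b rest bounds′) ⟩
  suc b ∎
  where
  open ≤-Reasoning
  last rest : Fin n → Bool
  last c = f c ≡ᵇ a + b
  rest c = P c ∧ not (last c)
  cover : ∀ c → P c ≡ true → last c ∨ rest c ≡ true
  cover c p with last c
  ... | true  = refl
  ... | false rewrite p = refl
  bounds′ : ∀ c → rest c ≡ true → a ≤ f c × f c < a + b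
  bounds′ c p with P c in eq | last c in eq′
  ... | true | false = proj₁ (bounds c eq) ,
    ≤∧≢⇒< (≤-pred (≤-trans (proj₂ (bounds c eq)) (≤-reflexive (+-suc a b))))
      (λ q → case trans (sym eq′) (Equivalence.to Bool.T-≡ (≡⇒≡ᵇ (f c) (a + b) q)) of λ ())

-- Whoever beats `d` also beats `c`. The inequality is strict because `d` itself beats `c` but not
-- `d`.
rank-antitone : ∀ {n} (key : Fin n → ℕ) {c d} → key c < key d → rank key d < rank key c
rank-antitone {n} key {c} {d} lt = begin-strict
  rank key d                            <⟨ m<m+n (rank key d) (s≤s z≤n) ⟩
  rank key d + 1                        ≡⟨ cong (_+ 1) (card≡total P) ⟩
  total (λ _ → 1) P + 1                 ≡⟨ total-add (λ _ → 1) P (Bool.¬-not λ p → <-irrefl refl (<ᵇ-true {key d} p)) ⟨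
  total (λ _ → 1) (put P d true)        ≡⟨ card≡total (put P d true) ⟨
  card (put P d true)                   ≤⟨ card-⊆ sub ⟩
  rank key c                            ∎
  where
  open ≤-Reasoning
  P : Fin n → Bool
  P e = key d <ᵇ key e
  sub : ∀ e → put P d true e ≡ true → (key c <ᵇ key e) ≡ true
  sub e p with e ≟ d
  ... | yes refl = true-<ᵇ lt
  ... | no  e≢d  = true-<ᵇ (<-trans lt (<ᵇ-true {key d} {key e} (trans (sym (updateAt-minimal e d P e≢d)) p)))

rank-injective : ∀ {n} (key : Fin n → ℕ) → (∀ {c d} → key c ≡ key d → c ≡ d) →
  ∀ {c d} → rank key c ≡ rank key d → c ≡ d
rank-injective key inj {c} {d} eq with <-cmp (key c) (key d)
... | tri< lt _ _ = contradiction (rank-antitone key lt) (<-irrefl (sym eq))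
... | tri≈ _ p _  = inj p
... | tri> _ _ gt = contradiction (rank-antitone key gt) (<-irrefl eq)

card-window : ∀ {n} (key : Fin n → ℕ) → (∀ {c d} → key c ≡ key d → c ≡ d) → ∀ k W →
  let open Window key k W in card (λ c → not (low c) ∧ not (high c)) ≤ W + W
card-window key inj k W = card-interval (rank-injective key inj) (k ∸ W) (W + W) _ bounds
  where
  open Window key k W
  bounds : ∀ c → not (low c) ∧ not (high c) ≡ true → k ∸ W ≤ rank key c × rank key c < k ∸ W + (W + W)
  bounds c p with low c in eq | high c in eq′
  ... | false | false =
    ≤-trans (∸-monoˡ-≤ W (<ᵇ-false {rank key c + W} eq)) (≤-reflexive (m+n∸n≡m (rank key c) W)) ,
    -- If k < W, the truncated lower end k ∸ W is 0; the interval of length 2W starting there still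
    -- reaches k + W, as k ≤ W + (k ∸ W).
    ≤-trans (<ᵇ-false {k + W} eq′) (≤-trans (+-monoˡ-≤ W (≤-trans (m≤n+m∸n k W) (≤-reflexive (+-comm W (k ∸ W)))))
      (≤-reflexive (+-assoc (k ∸ W) W W)))

-- Votes, weights and keys of one profile.

module _ {m n} (u : Fin m → Maybe (Fin n)) where

  votes : Maybe (Fin n) → Fin n → Bool
  votes nothing  c = false
  votes (just d) c = does (d ≟ c)

  weight : Fin n → ℕ
  weight c = card λ a → votes (u a) c

  score : (Fin n → Bool) → ℕ
  score A = card λ a → maybe′ A false (u a)

  -- Double counting of the pairs of an agent and a selected candidate. An agent votes for at most
  -- one candidate, so for a fixed agent the sum over candidates collapses to one membership test.
  total-weight : ∀ A → total weight A ≡ score A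
  total-weight A = begin
    sum (λ c → ι (A c) * sum (λ a → ι (votes (u a) c)))      ≡⟨ sum-cong-≗ (λ c → *-distribˡ-sum (ι (A c)) (λ a → ι (votes (u a) c))) ⟩
    sum (λ c → sum (λ a → ι (A c) * ι (votes (u a) c)))      ≡⟨ ∑-comm (λ c a → ι (A c) * ι (votes (u a) c)) ⟩
    sum (λ a → sum (λ c → ι (A c) * ι (votes (u a) c)))      ≡⟨ sum-cong-≗ (λ a → single A (u a)) ⟩
    sum (λ a → ι (maybe′ A false (u a)))                     ∎
    where
    open ≡-Reasoning
    zeros : ∀ {n} (f : Fin n → ℕ) → sum (λ c → f c * 0) ≡ 0
    zeros {n} f = trans (sum-cong-≗ (λ c → *-zeroʳ (f c))) (sum-replicate-zero n)
    diagonal : ∀ {n} (f : Fin n → ℕ) d → sum (λ c → f c * ι (does (d ≟ c))) ≡ f d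
    diagonal f zero    = trans (cong₂ _+_ (*-identityʳ (f zero)) (zeros (f ∘ suc))) (+-identityʳ (f zero))
    diagonal f (suc d) = trans (cong₂ _+_ (*-zeroʳ (f zero)) (diagonal (f ∘ suc) d)) refl
    single : ∀ A v → sum (λ c → ι (A c) * ι (votes v c)) ≡ ι (maybe′ A false v)
    single A nothing  = zeros (ι ∘ A)
    single A (just d) = diagonal (ι ∘ A) d

  -- The weights, with ties broken in favour of smaller indices.
  key : Fin n → ℕ
  key c = weight c * n + (n ∸ toℕ c)

  key-positive : ∀ c → 0 < key c
  key-positive c = ≤-trans (m<n⇒0<n∸m (toℕ<n c)) (m≤n+m _ (weight c * n))

  -- The tie-breaking term lies between 1 and n, so it cannot outweigh one vote, which counts n; its
  -- positivity at `d` makes the inequality strict.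
  weight<⇒key< : ∀ {c d} → weight c < weight d → key c < key d
  weight<⇒key< {c} {d} lt = begin-strict
    weight c * n + (n ∸ toℕ c) ≤⟨ +-monoʳ-≤ (weight c * n) (m∸n≤m n (toℕ c)) ⟩
    weight c * n + n           ≡⟨ +-comm (weight c * n) n ⟩
    suc (weight c) * n         ≤⟨ *-monoˡ-≤ n lt ⟩
    weight d * n               <⟨ m<m+n (weight d * n) (m<n⇒0<n∸m (toℕ<n d)) ⟩
    key d                      ∎
    where open ≤-Reasoning

  key<⇒weight≤ : ∀ {c d} → key c < key d → weight c ≤ weight d
  key<⇒weight≤ lt = ≮⇒≥ λ gt → <-asym lt (weight<⇒key< gt)

  key-injective : ∀ {c d} → key c ≡ key d → c ≡ d
  key-injective {c} {d} eq with <-cmp (weight c) (weight d)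
  ... | tri< lt _ _ = contradiction (weight<⇒key< lt) (<-irrefl eq)
  ... | tri> _ _ gt = contradiction (weight<⇒key< gt) (<-irrefl (sym eq))
  ... | tri≈ _ p _  = toℕ-injective (∸-cancelˡ-≡ (<⇒≤ (toℕ<n c)) (<⇒≤ (toℕ<n d))
    (+-cancelˡ-≡ (weight c * n) _ _ (trans eq (cong (λ w → w * n + (n ∸ toℕ d)) (sym p)))))

-- The dynamic program

positive-∸ : ∀ a b → positive (a ∸ b) ≡ (b <ᵇ a)
positive-∸ zero    zero    = refl
positive-∸ zero    (suc b) = refl
positive-∸ (suc a) zero    = refl
positive-∸ (suc a) (suc b) = positive-∸ a b

positive-≤ : ∀ {a b} → positive (a ∸ b) ≡ false → a ≤ b
positive-≤ {a} {b} p = <ᵇ-false {b} (trans (sym (positive-∸ a b)) p)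

≤-positive : ∀ {a b} → a ≤ b → positive (a ∸ b) ≡ false
≤-positive p rewrite m≤n⇒m∸n≡0 p = refl

count : ∀ {X : Set} → (X → Bool) → List X → ℕ
count p []       = 0
count p (x ∷ xs) = if p x then suc (count p xs) else count p xs

count-tabulate : ∀ {X : Set} {n} (p : X → Bool) (f : Fin n → X) → count p (tabulate f) ≡ card (p ∘ f)
count-tabulate {n = zero}  p f = refl
count-tabulate {n = suc n} p f with p (f zero)
... | false = count-tabulate p (f ∘ suc)
... | true  = cong suc (count-tabulate p (f ∘ suc))

mem : ∀ {n} → List (Fin n) → Fin n → Bool
mem []      c = false
mem (a ∷ A) c = if does (a ≟ c) then true else mem A c

mem-filter : ∀ {n} (A : Fin n → Bool) cs c → mem (filterᵇ A cs) c ≡ A c ∧ mem cs c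
mem-filter A []       c = sym (Bool.∧-zeroʳ (A c))
mem-filter A (d ∷ cs) c with A d in eq | d ≟ c in eq′
... | true  | yes refl rewrite eq | eq′ = refl
... | false | yes refl rewrite eq = trans (mem-filter A cs c) (cong (_∧ mem cs c) eq)
... | true  | no _ rewrite eq′ = mem-filter A cs c
... | false | no _ = mem-filter A cs c

mem-tabulate : ∀ {m n} (f : Fin m → Fin n) i → mem (tabulate f) (f i) ≡ true
mem-tabulate {suc m} f zero with f zero ≟ f zero
... | yes _ = refl
... | no ¬p = contradiction refl ¬p
mem-tabulate {suc m} f (suc i) with f zero ≟ f (suc i)
... | yes _ = refl
... | no  _ = mem-tabulate (f ∘ suc) i

-- Mapping and concatenation merged into one right fold, the shape that the term `consAllᵗ`
-- computes.
consAll : ∀ {X : Set} → X → List (List X) → List (List X) → List (List X)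
consAll c []      base = base
consAll c (A ∷ L) base = (c ∷ A) ∷ consAll c L base

consAll≡ : ∀ {X : Set} (c : X) L base → consAll c L base ≡ map (c ∷_) L ++ base
consAll≡ c []      base = refl
consAll≡ c (A ∷ L) base = cong ((c ∷ A) ∷_) (consAll≡ c L base)

length-consAll : ∀ {X : Set} (c : X) L base → length (consAll c L base) ≡ length L + length base
length-consAll c []      base = refl
length-consAll c (A ∷ L) base = cong suc (length-consAll c L base)

consAll-short : ∀ {X : Set} {c : X} {L base b} → All (λ A → length A ≤ b) L → All (λ A → length A ≤ suc b) base →
  All (λ A → length A ≤ suc b) (consAll c L base)
consAll-short []       q = q
consAll-short (p ∷ ps) q = s≤s p ∷ consAll-short ps q

module Family {X : Set} (lo hi : X → Bool) where

  family : List X → List (List X)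
  family []       = [] ∷ []
  family (c ∷ cs) =
    if lo c then consAll c (family cs) []
    else (if hi c then family cs else consAll c (family cs) (family cs))

  free : X → Bool
  free c = not (lo c) ∧ not (hi c)

  length-family : ∀ cs → length (family cs) ≤ 2 ^ count free cs
  length-family [] = ≤-refl
  length-family (c ∷ cs) with lo c | hi c
  ... | true  | _     = ≤-trans (≤-reflexive (trans (length-consAll c (family cs) []) (+-identityʳ _))) (length-family cs)
  ... | false | true  = length-family cs
  ... | false | false = ≤-trans (≤-reflexive (length-consAll c (family cs) (family cs)))
    (+-mono-≤ (length-family cs) (≤-trans (length-family cs) (m≤m+n _ 0)))

  -- This hands the bound on the complete family down to all intermediate families that the fold
  -- over the candidates passes through.
  family-grows : ∀ c cs → length (family cs) ≤ length (family (c ∷ cs))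
  family-grows c cs with lo c | hi c
  ... | true  | _     = ≤-trans (m≤m+n _ 0) (≤-reflexive (sym (length-consAll c (family cs) [])))
  ... | false | true  = ≤-refl
  ... | false | false = ≤-trans (m≤m+n _ _) (≤-reflexive (sym (length-consAll c (family cs) (family cs))))

  family-short : ∀ cs → All (λ A → length A ≤ length cs) (family cs)
  family-short [] = z≤n ∷ []
  family-short (c ∷ cs) with lo c | hi c | family-short cs
  ... | true  | _     | ih = consAll-short ih []
  ... | false | true  | ih = All.map m≤n⇒m≤1+n ih
  ... | false | false | ih = consAll-short ih (All.map m≤n⇒m≤1+n ih)

  -- The hypothesis says that A obeys every forced decision. At each candidate the filter therefore
  -- takes a branch that the enumeration also takes.
  family-complete : ∀ (A : X → Bool) →
    (∀ c → (if lo c then not (A c) else (hi c ∧ A c)) ≡ false) →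
    ∀ cs → filterᵇ A cs ∈ family cs
  family-complete A fits [] = here refl
  family-complete A fits (c ∷ cs) with A c | lo c | hi c | fits c | family-complete A fits cs
  ... | true  | true  | _     | _ | ih rewrite consAll≡ c (family cs) [] = ∈-++⁺ˡ (∈-map⁺ (c ∷_) ih)
  ... | true  | false | false | _ | ih rewrite consAll≡ c (family cs) (family cs) = ∈-++⁺ˡ (∈-map⁺ (c ∷_) ih)
  ... | false | false | true  | _ | ih = ih
  ... | false | false | false | _ | ih rewrite consAll≡ c (family cs) (family cs) = ∈-++⁺ʳ (map (c ∷_) (family cs)) ih

Profile : ℕ → ℕ → Set
Profile m n = Fin m → Maybe (Fin n)

card-cong : ∀ {n} {A B : Fin n → Bool} → (∀ c → A c ≡ B c) → card A ≡ card B
card-cong p = ≤-antisym (card-⊆ λ c q → trans (sym (p c)) q) (card-⊆ λ c q → trans (p c) q)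

dist-sym : ∀ {n} (A B : Fin n → Bool) → dist A B ≡ dist B A
dist-sym A B = card-cong λ c → Bool.xor-comm (A c) (B c)

module Dynamic (m n k x ℓ W : ℕ) where

  -- `X` is the set of the preceding stage and `t` the distance required from it. The threshold is a
  -- parameter because the first stage has no predecessor and uses 0, while all later ones use ℓ.
  Solvable : List (Profile m n) → (Fin n → Bool) → ℕ → Set
  Solvable []       X t = ⊤
  Solvable (u ∷ us) X t =
    Σ[ A ∈ (Fin n → Bool) ] card A ≤ k × x ≤ score u A × t ≤ dist A X × Solvable us A ℓ

  -- Comparisons are tests of truncated differences and connectives are conditionals, matching the
  -- term `feasibleᵗ`. Cardinality and score go through `mem`, so lists stand for sets.
  feasible : Profile m n → List (Fin n) → Bool
  feasible u A = if positive (card (mem A) ∸ k) then false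
    else (if positive (x ∸ score u (mem A)) then false else true)

  Entry : Set
  Entry = ℕ × List (Fin n)

  fits : List Entry → List (Fin n) → Bool
  fits []              A = false
  fits ((t , B) ∷ acc) A = if positive (t ∸ dist (mem A) (mem B)) then fits acc A else true

  select : Profile m n → List Entry → List (List (Fin n)) → List Entry
  select u acc []      = []
  select u acc (A ∷ F) =
    if feasible u A then (if fits acc A then (ℓ , A) ∷ select u acc F else select u acc F)
    else select u acc F

  module Stage (u : Profile m n) where
    open Window (key u) k W public using (low; high)
    open Family low high public

  -- An entry (t , B) states that B extends to a solution of the remaining stages
  -- and must be at distance at least t from the preceding set; after the last
  -- stage a dummy entry imposes no condition.
  entries : List (Profile m n) → List Entry
  entries []       = (0 , []) ∷ []
  entries (u ∷ us) = select u (entries us) (Stage.family u (allFin n))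

  feasible-sound : ∀ u A → feasible u A ≡ true → card (mem A) ≤ k × x ≤ score u (mem A)
  feasible-sound u A p with positive (card (mem A) ∸ k) in eq₁ | positive (x ∸ score u (mem A)) in eq₂
  ... | false | false = positive-≤ eq₁ , positive-≤ eq₂

  feasible-complete : ∀ u A → card (mem A) ≤ k → x ≤ score u (mem A) → feasible u A ≡ true
  feasible-complete u A p q rewrite ≤-positive p | ≤-positive q = refl

  fits-sound : ∀ acc A → fits acc A ≡ true → ∃[ t ] ∃[ B ] (t , B) ∈ acc × t ≤ dist (mem A) (mem B)
  fits-sound ((t , B) ∷ acc) A p with positive (t ∸ dist (mem A) (mem B)) in eq
  ... | true  = let t , B , i , q = fits-sound acc A p in t , B , there i , q
  ... | false = t , B , here refl , positive-≤ eq

  fits-complete : ∀ {acc t B} A → (t , B) ∈ acc → t ≤ dist (mem A) (mem B) → fits acc A ≡ true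
  fits-complete A (here refl) p rewrite ≤-positive p = refl
  fits-complete {(t , B) ∷ _} A (there i) p with positive (t ∸ dist (mem A) (mem B))
  ... | false = refl
  ... | true  = fits-complete A i p

  select-sound : ∀ {u acc} F {t B} → (t , B) ∈ select u acc F →
    t ≡ ℓ × feasible u B ≡ true × fits acc B ≡ true
  select-sound {u} {acc} (A ∷ F) i with feasible u A in eq₁ | fits acc A in eq₂
  select-sound (A ∷ F) (here refl) | true | true = refl , eq₁ , eq₂
  select-sound (A ∷ F) (there i)   | true | true = select-sound F i
  select-sound (A ∷ F) i           | true | false = select-sound F i
  select-sound (A ∷ F) i           | false | _ = select-sound F i

  select-complete : ∀ {u acc F B} → B ∈ F → feasible u B ≡ true → fits acc B ≡ true →
    (ℓ , B) ∈ select u acc F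
  select-complete (here refl) p q rewrite p | q = here refl
  select-complete {u} {acc} {A ∷ F} (there i) p q with feasible u A | fits acc A
  ... | true  | true  = there (select-complete i p q)
  ... | true  | false = select-complete i p q
  ... | false | _     = select-complete i p q

  sound : ∀ us A → fits (entries us) A ≡ true → Solvable us (mem A) ℓ
  sound []       A p = tt
  sound (u ∷ us) A p =
    let t , B , i , q    = fits-sound (entries (u ∷ us)) A p
        t≡ℓ , feas , fit = select-sound (Stage.family u (allFin n)) i
        card≤ , x≤       = feasible-sound u B feas
    in mem B , card≤ , x≤ ,
       ≤-trans (≤-reflexive (sym t≡ℓ)) (≤-trans q (≤-reflexive (dist-sym (mem A) (mem B)))) , sound us B fit

  length-select : ∀ u acc F → length (select u acc F) ≤ length F
  length-select u acc [] = z≤n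
  length-select u acc (A ∷ F) with feasible u A | fits acc A
  ... | true  | true  = s≤s (length-select u acc F)
  ... | true  | false = m≤n⇒m≤1+n (length-select u acc F)
  ... | false | _     = m≤n⇒m≤1+n (length-select u acc F)

  select-short : ∀ u acc {F b} → All (λ A → length A ≤ b) F → All (λ e → length (proj₂ e) ≤ b) (select u acc F)
  select-short u acc [] = []
  select-short u acc {A ∷ F} (p ∷ ps) with feasible u A | fits acc A
  ... | true  | true  = p ∷ select-short u acc ps
  ... | true  | false = select-short u acc ps
  ... | false | _     = select-short u acc ps

  length-family≤ : ∀ u → length (Stage.family u (allFin n)) ≤ 2 ^ (W + W)
  length-family≤ u = ≤-trans (Stage.length-family u (allFin n)) (^-monoʳ-≤ 2
    (≤-trans (≤-reflexive (count-tabulate (Stage.free u) id)) (card-window (key u) (key-injective u) k W)))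

  length-entries : ∀ us → length (entries us) ≤ 2 ^ (W + W)
  length-entries []       = m^n>0 2 (W + W)
  length-entries (u ∷ us) = ≤-trans (length-select u (entries us) (Stage.family u (allFin n))) (length-family≤ u)

  family-short : ∀ u → All (λ A → length A ≤ n) (Stage.family u (allFin n))
  family-short u = subst (λ b → All (λ A → length A ≤ b) (Stage.family u (allFin n)))
    (length-tabulate id) (Stage.family-short u (allFin n))

  entries-short : ∀ us → All (λ e → length (proj₂ e) ≤ n) (entries us)
  entries-short []       = z≤n ∷ []
  entries-short (u ∷ us) = select-short u (entries us) (family-short u)

  module _ (k≤n : k ≤ n) (W-large : 4 * ℓ + 4 ≤ W) where

    private
      module E (u : Profile m n) =
        Exchange (weight u) (key u) (key-injective u) (key-positive u) (λ {c} {d} → key<⇒weight≤ u {c} {d}) k x ℓ W k≤n W-large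

    settle-stage : ∀ u {t₁ X₁ t₂ X₂ A} → t₁ ≤ ℓ → t₂ ≤ ℓ → card A ≤ k → x ≤ score u A →
      t₁ ≤ dist A X₁ → t₂ ≤ dist A X₂ →
      ∃[ B ] B ∈ Stage.family u (allFin n) × feasible u B ≡ true × t₁ ≤ dist (mem B) X₁ × t₂ ≤ dist (mem B) X₂
    settle-stage u {t₁} {X₁} {t₂} {X₂} {A} t₁≤ℓ t₂≤ℓ p q r s =
      let B , E.valid p′ q′ r′ s′ , fit = E.settled u t₁ X₁ t₁≤ℓ t₂ X₂ t₂≤ℓ
            (E.valid p (≤-trans q (≤-reflexive (sym (total-weight u A)))) r s)
          -- The enumeration lists each set in the order of `allFin`, so `B` has to be presented in
          -- this form.
          L = filterᵇ B (allFin n)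
          L≗B : ∀ c → mem L c ≡ B c
          L≗B c = trans (mem-filter B (allFin n) c) (trans (cong (B c ∧_) (mem-tabulate id c)) (Bool.∧-identityʳ (B c)))
          dist≡ = λ X → card-cong λ c → cong (_xor X c) (sym (L≗B c))
      in L , Stage.family-complete u B fit (allFin n) ,
         feasible-complete u L (≤-trans (≤-reflexive (card-cong L≗B)) p′)
           (≤-trans q′ (≤-reflexive (trans (total-weight u B) (card-cong λ a → maybe-cong (λ c → sym (L≗B c)) (u a))))) ,
         ≤-trans r′ (≤-reflexive (dist≡ X₁)) , ≤-trans s′ (≤-reflexive (dist≡ X₂))
      where
      maybe-cong : ∀ {A B : Fin n → Bool} → (∀ c → A c ≡ B c) → ∀ v → maybe′ A false v ≡ maybe′ B false v
      maybe-cong p nothing  = refl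
      maybe-cong p (just c) = p c

    -- Stages are settled front to back. The current set is exchanged against its already settled
    -- predecessor and the still original successor. Both distances survive, so the tail remains
    -- solvable relative to the new set and the induction goes on.
    complete : ∀ u us {X t} → t ≤ ℓ → Solvable (u ∷ us) X t →
      ∃[ B ] (ℓ , B) ∈ entries (u ∷ us) × t ≤ dist (mem B) X
    complete u [] {X} {t} t≤ℓ (A , p , q , r , _) =
      -- The last stage has no successor: the second threshold is 0, and `A` only fills the place of
      -- the neighbour.
      let B , B∈ , feas , r′ , _ = settle-stage u {X₂ = A} t≤ℓ (z≤n {ℓ}) p q r z≤n
      in B , select-complete B∈ feas (fits-complete {entries []} {0} {[]} B (here refl) z≤n) , r′
    complete u (v ∷ vs) {X} {t} t≤ℓ (A , p , q , r , C , p₁ , q₁ , r₁ , rest) =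
      let B , B∈ , feas , r′ , s′ = settle-stage u {X₂ = C} t≤ℓ ≤-refl p q r (≤-trans r₁ (≤-reflexive (dist-sym C A)))
          D , D∈ , near = complete v vs ≤-refl (C , p₁ , q₁ , ≤-trans s′ (≤-reflexive (dist-sym (mem B) C)) , rest)
      in B , select-complete B∈ feas (fits-complete B D∈ (≤-trans near (≤-reflexive (dist-sym (mem D) (mem B))))) , r′

-- Translation between subsets and Boolean functions, and the capping of the bounds.

card-subset : ∀ {n} (S : Subset n) → ∣ S ∣ ≡ card (lookup S)
card-subset []            = refl
card-subset (outside ∷ S) = card-subset S
card-subset (inside ∷ S)  = cong suc (card-subset S)

card-tabulate : ∀ {n} (A : Fin n → Bool) → ∣ Vec.tabulate A ∣ ≡ card A
card-tabulate A = trans (card-subset (Vec.tabulate A)) (card-cong (lookup∘tabulate A))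

dist-subset : ∀ {n} (S T : Subset n) → ∣ S Δ T ∣ ≡ dist (lookup S) (lookup T)
dist-subset []            []            = refl
dist-subset (outside ∷ S) (outside ∷ T) = dist-subset S T
dist-subset (outside ∷ S) (inside ∷ T)  = cong suc (dist-subset S T)
dist-subset (inside ∷ S)  (outside ∷ T) = cong suc (dist-subset S T)
dist-subset (inside ∷ S)  (inside ∷ T)  = dist-subset S T

score-subset : ∀ {m n} (u : Profile m n) S → ∣ preimage u S ∣ ≡ score u (lookup S)
score-subset u S = card-tabulate λ a → maybe′ (lookup S) outside (u a)

card≤n : ∀ {n} (A : Fin n → Bool) → card A ≤ n
card≤n {n} A = ≤-trans (card-⊆ {P = A} {λ _ → true} λ _ _ → refl) (≤-reflexive (card-true {n}))

-- A cap one above the largest attainable value keeps an unattainable demand unattainable. This is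
-- why x is capped at m + 1 and ℓ at n + 1.
capped⁻ : ∀ {b v y} → y ≤ b → suc b ⊓ v ≤ y → v ≤ y
capped⁻ y≤b p = ≮⇒≥ λ y<v → contradiction (≤-trans (⊓-glb (s≤s y≤b) y<v) p) (<-irrefl refl)

capped⁺ : ∀ b {v y} → v ≤ y → b ⊓ v ≤ y
capped⁺ b {v} p = ≤-trans (m⊓n≤n b v) p

module _ {m n k x ℓ W : ℕ} where
  open Dynamic m n k x ℓ W

  toSolvable : ∀ {τ} (p : Fin τ → Profile m n) (A : Fin τ → Fin n → Bool) →
    (∀ i → card (A i) ≤ k × x ≤ score (p i) (A i)) →
    (∀ i j → toℕ j ≡ suc (toℕ i) → ℓ ≤ dist (A i) (A j)) →
    ∀ {X t} → (∀ i → toℕ i ≡ 0 → t ≤ dist (A i) X) → Solvable (tabulate p) X t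
  toSolvable {zero}  p A ok far first = tt
  toSolvable {suc τ} p A ok far first =
    A zero , proj₁ (ok zero) , proj₂ (ok zero) , first zero refl ,
    toSolvable (p ∘ suc) (A ∘ suc) (ok ∘ suc) (λ i j q → far (suc i) (suc j) (cong suc q))
      λ i q → ≤-trans (far zero (suc i) (cong suc q)) (≤-reflexive (dist-sym (A zero) (A (suc i))))

  fromSolvable : ∀ {τ} (p : Fin τ → Profile m n) {X t} → Solvable (tabulate p) X t →
    Σ[ A ∈ (Fin τ → Fin n → Bool) ]
      (∀ i → card (A i) ≤ k × x ≤ score (p i) (A i)) ×
      (∀ i j → toℕ j ≡ suc (toℕ i) → ℓ ≤ dist (A i) (A j)) ×
      (∀ i → toℕ i ≡ 0 → t ≤ dist (A i) X)
  fromSolvable {zero}  p _ = (λ ()) , (λ ()) , (λ ()) , λ ()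
  fromSolvable {suc τ} p {X} {t} (A₀ , card≤ , x≤ , near , rest) with fromSolvable (p ∘ suc) rest
  ... | A , ok , far , first = A′ , ok′ , far′ , first′
    where
    A′ : Fin (suc τ) → Fin n → Bool
    A′ zero    = A₀
    A′ (suc i) = A i
    ok′ : ∀ i → card (A′ i) ≤ k × x ≤ score (p i) (A′ i)
    ok′ zero    = card≤ , x≤
    ok′ (suc i) = ok i
    far′ : ∀ i j → toℕ j ≡ suc (toℕ i) → ℓ ≤ dist (A′ i) (A′ j)
    far′ zero    (suc j) q = ≤-trans (first j (cong pred q)) (≤-reflexive (dist-sym (A j) A₀))
    far′ (suc i) (suc j) q = far i j (cong pred q)
    first′ : ∀ i → toℕ i ≡ 0 → t ≤ dist (A′ i) X
    first′ zero q = near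

nonEmpty : ∀ {X : Set} → List X → Bool
nonEmpty []      = false
nonEmpty (_ ∷ _) = true

module _ (J : Instance) where
  open Instance J
  private
    m = agents
    n = candidates

  module Capped = Dynamic m n (n ⊓ k) (suc m ⊓ x) (suc n ⊓ ℓ) (8 * (suc n ⊓ ℓ))
  open Capped

  answer : Bool
  answer = nonEmpty (entries (tabulate profile))

  private
    ∅ : Fin n → Bool
    ∅ _ = false

  solution⇒solvable : HasSolution J → Solvable (tabulate profile) ∅ 0
  solution⇒solvable (S , ok , far) = toSolvable {W = 8 * (suc n ⊓ ℓ)} profile (λ i → lookup (S i))
    (λ i → ⊓-glb (card≤n (lookup (S i))) (≤-trans (≤-reflexive (sym (card-subset (S i)))) (proj₁ (ok i))) ,
           capped⁺ (suc m) (≤-trans (proj₂ (ok i)) (≤-reflexive (score-subset (profile i) (S i)))))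
    (λ i j q → capped⁺ (suc n) (≤-trans (far i j q) (≤-reflexive (dist-subset (S i) (S j)))))
    λ _ _ → z≤n

  solvable⇒solution : Solvable (tabulate profile) ∅ 0 → HasSolution J
  solvable⇒solution s with fromSolvable {W = 8 * (suc n ⊓ ℓ)} profile s
  ... | A , ok , far , _ = (λ i → Vec.tabulate (A i)) ,
    (λ i → ≤-trans (≤-reflexive (card-tabulate (A i))) (≤-trans (proj₁ (ok i)) (m⊓n≤n n k)) ,
           ≤-trans (capped⁻ (card≤n (λ a → maybe′ (A i) false (profile i a))) (proj₂ (ok i)))
             (≤-reflexive (sym (trans (score-subset (profile i) (Vec.tabulate (A i)))
               (card-cong λ a → maybe-tabulate (A i) (profile i a)))))) ,
    (λ i j q → ≤-trans (capped⁻ (card≤n (λ c → A i c xor A j c)) (far i j q))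
      (≤-reflexive (sym (trans (dist-subset (Vec.tabulate (A i)) (Vec.tabulate (A j)))
        (card-cong λ c → cong₂ _xor_ (lookup∘tabulate (A i) c) (lookup∘tabulate (A j) c))))))
    where
    maybe-tabulate : ∀ (A : Fin n → Bool) v → maybe′ (lookup (Vec.tabulate A)) false v ≡ maybe′ A false v
    maybe-tabulate A nothing  = refl
    maybe-tabulate A (just c) = lookup∘tabulate A c

  answer-correct : Reflects (HasSolution J) answer
  answer-correct = decide (tabulate profile) refl
    where
    -- The capped ℓ is still positive, so the additive 4 fits into another 4ℓ.
    8*-large : ∀ ℓ → ⦃ NonZero ℓ ⦄ → 4 * (suc n ⊓ ℓ) + 4 ≤ 8 * (suc n ⊓ ℓ)
    8*-large (suc ℓ) = ≤-trans (+-monoʳ-≤ (4 * suc (n ⊓ ℓ)) (m≤m*n 4 (suc (n ⊓ ℓ))))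
      (≤-reflexive (sym (*-distribʳ-+ (suc (n ⊓ ℓ)) 4 4)))
    decide : ∀ us → us ≡ tabulate profile → Reflects (HasSolution J) (nonEmpty (entries us))
    decide [] eq = ofʸ (solvable⇒solution (subst (λ us → Solvable us ∅ 0) eq tt))
    decide (u ∷ us) eq with entries (u ∷ us) in eq′
    ... | [] = ofⁿ λ s →
      let B , B∈ , _ = complete (m⊓n≤m n k) (8*-large ℓ) u us z≤n
                         (subst (λ us → Solvable us ∅ 0) (sym eq) (solution⇒solvable s))
      in case subst ((suc n ⊓ ℓ , B) ∈_) eq′ B∈ of λ ()
    ... | (t , B) ∷ _ =
      let _ , feas , fit = select-sound {u} {entries us} (Stage.family u (allFin n)) (subst ((t , B) ∈_) (sym eq′) (here refl))
          card≤ , x≤     = feasible-sound u B feas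
      in ofʸ (solvable⇒solution (subst (λ us → Solvable us ∅ 0) eq (mem B , card≤ , x≤ , z≤n , sound us B fit)))

-- The dynamic program as a term

⟨_⟩ : List Tree → Tree
⟨_⟩ = List.foldr node leaf

tuple : List Term → Term
tuple []       = leaf
tuple (a ∷ as) = node a (tuple as)

invoke : Term → List Term → Term
invoke f as = app f (tuple as)

trueᵗ : Term
trueᵗ = node leaf leaf

incr : Term → Term
incr = node leaf

predᵗ : Term → Term
predᵗ a = case a leaf (var 1)

isPositive : Term → Term
isPositive a = case a leaf trueᵗ

countᵗ : Term → Term → Term
countᵗ l p = fold l leaf (case p (var 1) (incr (var 3)))

lengthᵗ monus plus times minimum capped : Term
lengthᵗ = fold (var 0) leaf (incr (var 1))
monus   = fold (var 1) (var 0) (predᵗ (var 1))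
plus    = fold (var 0) (var 1) (incr (var 1))
times   = fold (var 0) leaf (invoke plus (var 3 ∷ var 1 ∷ []))
minimum = invoke monus (var 0 ∷ invoke monus (var 0 ∷ var 1 ∷ []) ∷ [])
capped  = fold (var 1) leaf
  (case (var 0)
    (invoke minimum (var 2 ∷ invoke plus (var 1 ∷ incr (incr (var 1)) ∷ []) ∷ []))
    (invoke minimum (var 4 ∷ invoke plus (var 3 ∷ incr (var 3) ∷ []) ∷ [])))

-- Arguments, with cs the list of candidates and n its length:
-- member (c, A), weightᵗ (c, u), keyᵗ (c, n, u), rankᵗ (c, cs, n, u),
-- distᵗ (A, B, cs), scoreᵗ (A, u).
member weightᵗ keyᵗ rankᵗ distᵗ scoreᵗ : Term
member  = fold (var 1) leaf (case (equal (var 0) (var 2)) (var 1) trueᵗ)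
weightᵗ = countᵗ (var 1) (equal (var 0) (node leaf (var 2)))
keyᵗ    = invoke plus
  (invoke times (invoke weightᵗ (var 0 ∷ var 2 ∷ []) ∷ var 1 ∷ [])
   ∷ invoke monus (var 1 ∷ invoke capped (var 1 ∷ var 0 ∷ []) ∷ []) ∷ [])
rankᵗ   = countᵗ (var 1) (isPositive (invoke monus
  (invoke keyᵗ (var 0 ∷ var 4 ∷ var 5 ∷ []) ∷ invoke keyᵗ (var 2 ∷ var 4 ∷ var 5 ∷ []) ∷ [])))
distᵗ   = countᵗ (var 2)
  (case (equal (invoke member (var 0 ∷ var 2 ∷ [])) (invoke member (var 0 ∷ var 3 ∷ []))) trueᵗ leaf)
scoreᵗ  = countᵗ (var 1) (case (var 0) leaf (invoke member (var 1 ∷ var 4 ∷ [])))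

-- Arguments: consAllᵗ (c, sets, base), extendᵗ (rank of c, c, sets, k, W),
-- familyᵗ (cs, n, u, k, W), feasibleᵗ (A, cs, u, k, x), fitsᵗ (A, cs, entries),
-- selectᵗ (u, entries, cs, n, k, x, ℓ, W), entriesᵗ (us, cs, n, k, x, ℓ, W).
consAllᵗ extendᵗ familyᵗ feasibleᵗ fitsᵗ selectᵗ entriesᵗ : Term
consAllᵗ  = fold (var 1) (var 2) (node (node (var 2) (var 0)) (var 1))
extendᵗ   = case (invoke monus (var 3 ∷ invoke plus (var 0 ∷ var 4 ∷ []) ∷ []))
  (case (invoke monus (incr (var 0) ∷ invoke plus (var 3 ∷ var 4 ∷ []) ∷ []))
    (invoke consAllᵗ (var 1 ∷ var 2 ∷ var 2 ∷ []))
    (var 4))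
  (invoke consAllᵗ (var 3 ∷ var 4 ∷ leaf ∷ []))
familyᵗ   = fold (var 0) (node leaf leaf)
  (invoke extendᵗ (invoke rankᵗ (var 0 ∷ var 2 ∷ var 3 ∷ var 4 ∷ []) ∷ var 0 ∷ var 1 ∷ var 5 ∷ var 6 ∷ []))
feasibleᵗ = case (invoke monus (invoke distᵗ (var 0 ∷ leaf ∷ var 1 ∷ []) ∷ var 3 ∷ []))
  (case (invoke monus (var 4 ∷ invoke scoreᵗ (var 0 ∷ var 2 ∷ []) ∷ [])) trueᵗ leaf)
  leaf
fitsᵗ     = fold (var 2) leaf
  (case (var 0) leaf
    (case (invoke monus (var 0 ∷ invoke distᵗ (var 4 ∷ var 1 ∷ var 5 ∷ []) ∷ [])) trueᵗ (var 5)))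
selectᵗ   = fold (invoke familyᵗ (var 2 ∷ var 3 ∷ var 0 ∷ var 4 ∷ var 7 ∷ [])) leaf
  (case (invoke feasibleᵗ (var 0 ∷ var 4 ∷ var 2 ∷ var 6 ∷ var 7 ∷ []))
    (var 1)
    (case (invoke fitsᵗ (var 2 ∷ var 6 ∷ var 5 ∷ []))
      (var 3)
      (node (node (var 12) (var 4)) (var 5))))
entriesᵗ  = fold (var 0) (node (node leaf leaf) leaf)
  (invoke selectᵗ (var 0 ∷ var 1 ∷ var 3 ∷ var 4 ∷ var 5 ∷ var 6 ∷ var 7 ∷ var 8 ∷ []))

numeral : ℕ → Term
numeral zero    = leaf
numeral (suc n) = incr (numeral n)

-- Arguments: decide (us, cs, n, k, x, ℓ), uncapped (us, cs, n, m, k, x, ℓ), where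
-- k, x and ℓ are unary for decide and binary for uncapped.
decide uncapped main : Term
decide   = isPositive
  (invoke entriesᵗ (var 0 ∷ var 1 ∷ var 2 ∷ var 3 ∷ var 4 ∷ var 5 ∷ invoke times (numeral 8 ∷ var 5 ∷ []) ∷ []))
uncapped = invoke decide (var 0 ∷ var 1 ∷ var 2 ∷ invoke capped (var 2 ∷ var 4 ∷ [])
  ∷ invoke capped (incr (var 3) ∷ var 5 ∷ []) ∷ invoke capped (incr (var 2) ∷ var 6 ∷ []) ∷ [])
main     = invoke uncapped (var 2 ∷ var 1 ∷ invoke lengthᵗ (var 1 ∷ []) ∷ invoke lengthᵗ (var 0 ∷ [])
  ∷ var 3 ∷ var 4 ∷ sixth ∷ [])
  where
  tail : Term → Term
  tail a = case a leaf (var 1)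
  -- The encoded instance ends with ℓ itself and not with `leaf`, so ℓ is the fifth tail; `var 5`
  -- would read only its lowest digit.
  sixth = tail (tail (tail (tail (tail env))))

-- Comparison of encoded data and decoding of binary numbers.

treeEq-refl : ∀ u → treeEq u u ≡ true
treeEq-refl leaf       = refl
treeEq-refl (node u v) rewrite treeEq-refl u = treeEq-refl v

treeEq-sound : ∀ u v → treeEq u v ≡ true → u ≡ v
treeEq-sound leaf leaf p = refl
treeEq-sound (node u₁ u₂) (node v₁ v₂) p with treeEq u₁ v₁ in eq
... | true = cong₂ node (treeEq-sound u₁ v₁ eq) (treeEq-sound u₂ v₂ p)

treeEq-bool : ∀ a b → not (treeEq (encodeBool a) (encodeBool b)) ≡ a xor b
treeEq-bool false false = refl
treeEq-bool false true  = refl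
treeEq-bool true  false = refl
treeEq-bool true  true  = refl

node-injectiveʳ : ∀ {s t u v : Tree} → node s t ≡ node u v → t ≡ v
node-injectiveʳ refl = refl

encodeℕᵇ-injective : ∀ {a b} → encodeℕᵇ a ≡ encodeℕᵇ b → a ≡ b
encodeℕᵇ-injective {ℕᵇ.zero} {ℕᵇ.zero} p = refl
encodeℕᵇ-injective {2[1+ a ]} {2[1+ b ]} p = cong 2[1+_] (encodeℕᵇ-injective (node-injectiveʳ p))
encodeℕᵇ-injective {1+[2 a ]} {1+[2 b ]} p = cong 1+[2_] (encodeℕᵇ-injective (node-injectiveʳ p))

encodeFin-injective : ∀ {n} {c d : Fin n} → encodeFin c ≡ encodeFin d → c ≡ d
encodeFin-injective {c = c} {d} p = toℕ-injective (trans (sym (toℕ-fromℕ (toℕ c)))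
  (trans (cong ℕᵇ.toℕ (encodeℕᵇ-injective p)) (toℕ-fromℕ (toℕ d))))

treeEq-fin : ∀ {n} (c d : Fin n) → treeEq (encodeFin c) (encodeFin d) ≡ does (c ≟ d)
treeEq-fin c d with c ≟ d
... | yes refl = treeEq-refl (encodeFin c)
... | no  c≢d  = Bool.¬-not λ p → c≢d (encodeFin-injective (treeEq-sound _ _ p))

-- The digits form a list, so the rule for folds over encoded lists applies to binary numbers;
-- `false` is the digit 2 and `true` the digit 1.
bits : ℕᵇ → List Bool
bits ℕᵇ.zero   = []
bits 2[1+ b ] = false ∷ bits b
bits 1+[2 b ] = true ∷ bits b

bitsValue : List Bool → ℕ
bitsValue []           = 0
bitsValue (false ∷ bs) = 2 * suc (bitsValue bs)
bitsValue (true ∷ bs)  = suc (2 * bitsValue bs)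

encode-bits : ∀ b → encodeℕᵇ b ≡ encodeList encodeBool (bits b)
encode-bits ℕᵇ.zero   = refl
encode-bits 2[1+ b ] = cong (node leaf) (encode-bits b)
encode-bits 1+[2 b ] = cong (node _) (encode-bits b)

bitsValue-bits : ∀ b → bitsValue (bits b) ≡ ℕᵇ.toℕ b
bitsValue-bits ℕᵇ.zero   = refl
bitsValue-bits 2[1+ b ] = cong (λ v → 2 * suc v) (bitsValue-bits b)
bitsValue-bits 1+[2 b ] = cong (λ v → suc (2 * v)) (bitsValue-bits b)

length≤size : ∀ {X : Set} (f : X → Tree) xs → length xs ≤ size (encodeList f xs)
length≤size f []       = z≤n
length≤size f (x ∷ xs) = s≤s (≤-trans (length≤size f xs) (m≤n+m _ (size (f x))))

-- If c ≤ v, both sides are c, because f does not decrease its argument; otherwise the inner minimum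
-- is v. Hence a cap applied after every digit has the same effect as one at the end, and unary
-- intermediate values stay below about twice the cap.
⊓-absorb : ∀ c v (f : ℕ → ℕ) → (∀ v → v ≤ f v) → c ⊓ f (c ⊓ v) ≡ c ⊓ f v
⊓-absorb c v f p with ≤-total c v
... | inj₁ c≤v rewrite m≤n⇒m⊓n≡m c≤v = trans (m≤n⇒m⊓n≡m (p c)) (sym (m≤n⇒m⊓n≡m (≤-trans c≤v (p v))))
... | inj₂ v≤c rewrite m≥n⇒m⊓n≡n v≤c = refl

∸∸≡⊓ : ∀ m n → m ∸ (m ∸ n) ≡ m ⊓ n
∸∸≡⊓ m n = trans (cong (_∸ (m ∸ n)) (sym (m⊓n+n∸m≡n n m))) (trans (m+n∸n≡m (n ⊓ m) (m ∸ n)) (⊓-comm n m))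

-- Running times

-- All running times are bounded by powers of one number N, chosen at the end to
-- dominate both 2^(16ℓ) and the square of the input size.
module Timing (N : ℕ) (64≤N : 64 ≤ N) where

  -- Costs are recorded by their degree in N only: a constant up to 64 is absorbed by one factor N,
  -- so the rules below merely compute with exponents.
  record Runs (e : Term) (ρ v : Tree) (d : ℕ) : Set where
    constructor runs
    field
      value : ⟦ e ⟧ ρ ≡ v
      bound : cost e ρ ≤ N ^ d

  open Runs

  instance
    N≢0 : NonZero N
    N≢0 = >-nonZero (≤-trans (s≤s z≤n) 64≤N)

  N^≢0 : ∀ d → NonZero (N ^ d)
  N^≢0 d = m^n≢0 N d

  absorb : ∀ M {t} → t ≤ 64 * M → t ≤ N * M
  absorb M p = ≤-trans p (*-monoˡ-≤ M 64≤N)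

  weaken : ∀ {e ρ v d} d′ {_ : True (d ≤? d′)} → Runs e ρ v d → Runs e ρ v d′
  weaken d′ {p} (runs q b) = runs q (≤-trans b (^-monoʳ-≤ N (toWitness p)))

  infixl 1 _▹_
  _▹_ : ∀ {e ρ v v′ d} → Runs e ρ v d → v ≡ v′ → Runs e ρ v′ d
  r ▹ refl = r

  ≤^-left : ∀ {x} d e → x ≤ N ^ d → x ≤ N ^ (d ⊔ e)
  ≤^-left d e p = ≤-trans p (^-monoʳ-≤ N (m≤m⊔n d e))

  ≤^-right : ∀ {x} d e → x ≤ N ^ e → x ≤ N ^ (d ⊔ e)
  ≤^-right d e p = ≤-trans p (^-monoʳ-≤ N (m≤n⊔m d e))

  constant : ∀ {k} → {_ : True (k ≤? 64)} → k ≤ N ^ 1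
  constant {k} {p} = subst (k ≤_) (sym (^-identityʳ N)) (≤-trans (toWitness p) 64≤N)

  -- A lookup costs 7 per skipped entry, which exceeds 64 for distant variables; hence degree 2.
  rVar : ∀ i {ρ} → {_ : True (cost (var i) ρ ≤? 256)} → Runs (var i) ρ (look i ρ) 2
  rVar i {ρ} {p} = runs refl (≤-trans (toWitness p) (≤-trans (*-monoˡ-≤ 4 64≤N)
    (*-monoʳ-≤ N (≤-trans (≤-trans (toWitness {a? = 4 ≤? 64} _) 64≤N) (m≤m*n N 1)))))

  rEnv : ∀ {ρ} → Runs env ρ ρ 1
  rEnv = runs refl constant

  rLeaf : ∀ {ρ} → Runs leaf ρ leaf 1
  rLeaf = runs refl constant

  private
    -- With two summands of at most M each, an overhead of 62 M exhausts the 64 M that one factor N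
    -- can absorb.
    binary : ∀ k {x y} d e → k ≤ 62 → x ≤ N ^ d → y ≤ N ^ e → k + (x + y) ≤ N ^ suc (d ⊔ e)
    binary k {x} {y} d e k≤62 p q = absorb M (begin
      k + (x + y)      ≤⟨ +-mono-≤ (≤-trans k≤62 (m≤m*n 62 M ⦃ N^≢0 (d ⊔ e) ⦄))
                            (+-mono-≤ (≤^-left d e p) (≤^-right d e q)) ⟩
      62 * M + (M + M) ≡⟨ lemma M ⟩
      64 * M ∎)
      where
      open ≤-Reasoning
      M = N ^ (d ⊔ e)
      lemma : ∀ M → 62 * M + (M + M) ≡ 64 * M
      lemma = solve-∀

  rNode : ∀ {a b ρ u v d e} → Runs a ρ u d → Runs b ρ v e → Runs (node a b) ρ (node u v) (suc (d ⊔ e))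
  rNode {a} {b} {ρ} {d = d} {e} (runs p x) (runs q y) = runs (cong₂ node p q)
    (≤-trans (≤-reflexive (lemma (cost a ρ) (cost b ρ))) (binary 17 d e (toWitness {a? = 17 ≤? 62} _) x y))
    where
    lemma : ∀ x y → 11 + ((3 + x) + (3 + y)) ≡ 17 + (x + y)
    lemma = solve-∀

  rApp : ∀ {f a ρ u v d e} → Runs a ρ u d → Runs f u v e → Runs (app f a) ρ v (suc (d ⊔ e))
  rApp {f} {a} {ρ} {u} {d = d} {e} (runs refl x) (runs q y) = runs q
    (≤-trans (≤-reflexive (lemma (cost a ρ) (cost f u))) (binary 21 d e (toWitness {a? = 21 ≤? 62} _) x y))
    where
    lemma : ∀ x y → 18 + (((3 + x) + 0) + y) ≡ 21 + (x + y)
    lemma = solve-∀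

  rCase-leaf : ∀ {a b c ρ v d e} → Runs a ρ leaf d → Runs b ρ v e → Runs (case a b c) ρ v (suc (d ⊔ e))
  rCase-leaf {a} {b} {c} {ρ} {v} {d} {e} (runs p x) (runs q y) = runs
    (trans (cong (λ r → branch r _ _) p) q)
    (≤-trans (≤-reflexive (trans (cong (λ r → 15 + ((3 + cost a ρ) + branch r _ _)) p) (lemma (cost a ρ) (cost b ρ))))
      (binary 21 d e (toWitness {a? = 21 ≤? 62} _) x y))
    where
    lemma : ∀ x y → 15 + ((3 + x) + (3 + y)) ≡ 21 + (x + y)
    lemma = solve-∀

  rCase-node : ∀ {a b c ρ u w v d e} → Runs a ρ (node u w) d → Runs c (node u (node w ρ)) v e →
    Runs (case a b c) ρ v (suc (d ⊔ e))
  rCase-node {a} {b} {c} {ρ} {u} {w} {v} {d} {e} (runs p x) (runs q y) = runs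
    (trans (cong (λ r → branch r _ _) p) q)
    (≤-trans (≤-reflexive (trans (cong (λ r → 15 + ((3 + cost a ρ) + branch r _ _)) p) (lemma (cost a ρ) _)))
      (binary 25 d e (toWitness {a? = 25 ≤? 62} _) x y))
    where
    lemma : ∀ x y → 15 + ((3 + x) + (7 + y)) ≡ 25 + (x + y)
    lemma = solve-∀

  raise : ∀ {e ρ v d d′} → d ≤ d′ → Runs e ρ v d → Runs e ρ v d′
  raise p (runs q b) = runs q (≤-trans b (^-monoʳ-≤ N p))

  rIf : ∀ {a b c ρ u w d e f} (t : Bool) → Runs a ρ (encodeBool t) d →
    Runs b ρ u e → Runs c (node leaf (node leaf ρ)) w f →
    Runs (case a b c) ρ (if t then w else u) (suc (d ⊔ (e ⊔ f)))
  rIf {d = d} {e} {f} false r r₁ r₂ = raise (s≤s (⊔-monoʳ-≤ d (m≤m⊔n e f))) (rCase-leaf r r₁)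
  rIf {d = d} {e} {f} true  r r₁ r₂ = raise (s≤s (⊔-monoʳ-≤ d (m≤n⊔m e f))) (rCase-node r r₂)

  rPositive : ∀ {a b c ρ u w d e f} n → Runs a ρ (nat n) d →
    Runs b ρ u e → (∀ m → Runs c (node leaf (node (nat m) ρ)) w f) →
    Runs (case a b c) ρ (if positive n then w else u) (suc (d ⊔ (e ⊔ f)))
  rPositive {d = d} {e} {f} zero    r r₁ r₂ = raise (s≤s (⊔-monoʳ-≤ d (m≤m⊔n e f))) (rCase-leaf r r₁)
  rPositive {d = d} {e} {f} (suc n) r r₁ r₂ = raise (s≤s (⊔-monoʳ-≤ d (m≤n⊔m e f))) (rCase-node r (r₂ n))

  -- The comparison descends both trees in parallel and stops where one of them ends, so the size of
  -- the first tree alone bounds it.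
  eqCost≤ : ∀ u v → eqCost u v ≤ 16 * size u
  eqCost≤ leaf leaf = toWitness {a? = 7 ≤? 16} _
  eqCost≤ leaf (node _ _) = toWitness {a? = 5 ≤? 16} _
  eqCost≤ (node u₁ u₂) leaf = ≤-trans (toWitness {a? = 5 ≤? 16} _) (m≤m*n 16 (size (node u₁ u₂)))
  eqCost≤ (node u₁ u₂) (node v₁ v₂) with treeEq u₁ v₁ | eqCost≤ u₁ v₁ | eqCost≤ u₂ v₂
  ... | true | p | q = begin
      8 + (eqCost u₁ v₁ + (3 + eqCost u₂ v₂)) ≤⟨ +-monoʳ-≤ 8 (+-mono-≤ p (+-monoʳ-≤ 3 q)) ⟩
      8 + (16 * size u₁ + (3 + 16 * size u₂)) ≤⟨ m≤n+m _ 5 ⟩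
      5 + (8 + (16 * size u₁ + (3 + 16 * size u₂))) ≡⟨ lemma (size u₁) (size u₂) ⟩
      16 * suc (size u₁ + size u₂) ∎
    where
    open ≤-Reasoning
    lemma : ∀ x y → 5 + (8 + (16 * x + (3 + 16 * y))) ≡ 16 * suc (x + y)
    lemma = solve-∀
  ... | false | p | q = begin
      8 + (eqCost u₁ v₁ + 1)         ≤⟨ +-monoʳ-≤ 8 (+-monoˡ-≤ 1 p) ⟩
      8 + (16 * size u₁ + 1)         ≤⟨ m≤m+n _ (7 + 16 * size u₂) ⟩
      8 + (16 * size u₁ + 1) + (7 + 16 * size u₂) ≡⟨ lemma (size u₁) (size u₂) ⟩
      16 * suc (size u₁ + size u₂) ∎
    where
    open ≤-Reasoning
    lemma : ∀ x y → 8 + (16 * x + 1) + (7 + 16 * y) ≡ 16 * suc (x + y)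
    lemma = solve-∀

  rEq : ∀ {a b ρ u v d e} → size u ≤ N → Runs a ρ u d → Runs b ρ v e →
    Runs (equal a b) ρ (encodeBool (treeEq u v)) (2 + (d ⊔ e))
  rEq {a} {b} {ρ} {u} {v} {d} {e} u≤N (runs refl x) (runs refl y) = runs refl (begin
      cost (equal a b) ρ
        ≤⟨ +-mono-≤ (m≤m*n 17 NM) (+-mono-≤ (+-mono-≤ (+-mono-≤ (m≤m*n 3 NM) x′) (+-mono-≤ (+-mono-≤ (m≤m*n 3 NM) y′) z≤n))
            (≤-trans (eqCost≤ u v) (*-monoʳ-≤ 16 (≤-trans u≤N (m≤m*n N M))))) ⟩
      17 * NM + (((3 * NM + NM) + ((3 * NM + NM) + 0)) + 16 * NM) ≡⟨ lemma NM ⟩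
      41 * NM ≤⟨ *-monoˡ-≤ NM (toWitness {a? = 41 ≤? 64} _) ⟩
      64 * NM ≤⟨ *-monoˡ-≤ NM 64≤N ⟩
      N * NM ∎)
    where
    open ≤-Reasoning
    M = N ^ (d ⊔ e)
    NM = N * M
    instance
      M≢0 : NonZero M
      M≢0 = N^≢0 (d ⊔ e)
      NM≢0 : NonZero NM
      NM≢0 = N^≢0 (suc (d ⊔ e))
    x′ : cost a ρ ≤ NM
    x′ = ≤-trans (≤^-left d e x) (m≤n*m M N)
    y′ : cost b ρ ≤ NM
    y′ = ≤-trans (≤^-right d e y) (m≤n*m M N)
    lemma : ∀ x → 17 * x + (((3 * x + x) + ((3 * x + x) + 0)) + 16 * x) ≡ 41 * x
    lemma = solve-∀

  -- A right fold passes through the suffixes of the list: `g` gives the accumulator after each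
  -- suffix, and `P` is an invariant inherited by suffixes on which the step may rely.
  module _ {X : Set} {f : X → Tree} (g : List X → Tree) (P : List X → Set)
           (P-tail : ∀ {x ys} → P (x ∷ ys) → P ys) {s ρ d}
           (step : ∀ x ys → P (x ∷ ys) → Runs s (node (f x) (node (g ys) ρ)) (g (x ∷ ys)) d) where

    private
      F : Tree → Tree → Tree
      F h acc = ⟦ s ⟧ (node h (node acc ρ))
      C : Tree → Tree → ℕ
      C h acc = cost s (node h (node acc ρ))

    foldTree-list : ∀ xs → P xs → foldTree F (g []) (encodeList f xs) ≡ g xs
    foldTree-list []       p = refl
    foldTree-list (x ∷ xs) p = trans (cong (F (f x)) (foldTree-list xs (P-tail p))) (value (step x xs p))

    -- A round costs 13 steps besides the call of the step term, which costs at most M; this is at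
    -- most 14 M per round.
    loopCost≤ : ∀ {M} ⦃ _ : NonZero M ⦄ → N ^ d ≤ M → ∀ xs → P xs →
      loopCost F C (g []) (encodeList f xs) ≤ suc (length xs) * (14 * M)
    loopCost≤ {M} N^d≤M [] p = ≤-trans (≤-trans (toWitness {a? = 3 ≤? 14} _) (m≤m*n 14 M)) (m≤m+n (14 * M) 0)
    loopCost≤ {M} N^d≤M (x ∷ xs) p = begin
      12 + (((L + 1) + 0) + C (f x) (foldTree F (g []) (encodeList f xs)))
        ≡⟨ cong (λ r → 12 + (((L + 1) + 0) + C (f x) r)) (foldTree-list xs (P-tail p)) ⟩
      12 + (((L + 1) + 0) + C (f x) (g xs))
        ≤⟨ +-monoʳ-≤ 12 (+-mono-≤ (+-monoˡ-≤ 0 (+-monoˡ-≤ 1 (loopCost≤ N^d≤M xs (P-tail p))))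
             (≤-trans (bound (step x xs p)) N^d≤M)) ⟩
      12 + (((suc (length xs) * (14 * M) + 1) + 0) + M) ≡⟨ lemma₁ (suc (length xs) * (14 * M)) M ⟩
      suc (length xs) * (14 * M) + (13 + M) ≤⟨ +-monoʳ-≤ (suc (length xs) * (14 * M)) (+-monoˡ-≤ M (m≤m*n 13 M)) ⟩
      suc (length xs) * (14 * M) + (13 * M + M) ≡⟨ lemma₂ (length xs) M ⟩
      suc (suc (length xs)) * (14 * M) ∎
      where
      open ≤-Reasoning
      L = loopCost F C (g []) (encodeList f xs)
      lemma₁ : ∀ x M → 12 + (((x + 1) + 0) + M) ≡ x + (13 + M)
      lemma₁ = solve-∀
      lemma₂ : ∀ l M → suc l * (14 * M) + (13 * M + M) ≡ suc (suc l) * (14 * M)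
      lemma₂ = solve-∀

    -- Of the two additional degrees, one pays for up to N rounds and the other absorbs the
    -- constants, which add up to 55.
    rFold : ∀ {l z xs d₁ d₂} → length xs ≤ N → P xs → Runs l ρ (encodeList f xs) d₁ → Runs z ρ (g []) d₂ →
      Runs (fold l z s) ρ (g xs) (2 + (d₁ ⊔ (d₂ ⊔ d)))
    rFold {l} {z} {xs} {d₁} {d₂} len p (runs q x) (runs q′ y) = runs
      (trans (cong₂ (foldTree F) q′ q) (foldTree-list xs p))
      (begin
        17 + (((3 + cost l ρ) + ((3 + cost z ρ) + 2)) + loopCost F C (⟦ z ⟧ ρ) (⟦ l ⟧ ρ))
          ≡⟨ cong₂ (λ r r′ → 17 + (((3 + cost l ρ) + ((3 + cost z ρ) + 2)) + loopCost F C r r′)) q′ q ⟩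
        17 + (((3 + cost l ρ) + ((3 + cost z ρ) + 2)) + loopCost F C (g []) (encodeList f xs))
          ≤⟨ +-mono-≤ (m≤m*n 17 NM) (+-mono-≤ (+-mono-≤ (+-mono-≤ (m≤m*n 3 NM) (up x′))
               (+-mono-≤ (+-mono-≤ (m≤m*n 3 NM) (up y′)) (m≤m*n 2 NM)))
               (≤-trans (loopCost≤ {M} z′ xs p) (*-monoˡ-≤ (14 * M) (s≤s len)))) ⟩
        17 * NM + (((3 * NM + NM) + ((3 * NM + NM) + 2 * NM)) + suc N * (14 * M))
          ≤⟨ +-monoʳ-≤ (17 * NM) (+-monoʳ-≤ ((3 * NM + NM) + ((3 * NM + NM) + 2 * NM))
               (≤-trans (*-monoˡ-≤ (14 * M) (+-monoˡ-≤ N (>-nonZero⁻¹ N))) (≤-reflexive (lemma₁ N M)))) ⟩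
        17 * NM + (((3 * NM + NM) + ((3 * NM + NM) + 2 * NM)) + 28 * NM) ≡⟨ lemma NM ⟩
        55 * NM ≤⟨ *-monoˡ-≤ NM (toWitness {a? = 55 ≤? 64} _) ⟩
        64 * NM ≤⟨ *-monoˡ-≤ NM 64≤N ⟩
        N * NM ∎)
      where
      open ≤-Reasoning
      M = N ^ (d₁ ⊔ (d₂ ⊔ d))
      NM = N * M
      instance
        M≢0 : NonZero M
        M≢0 = N^≢0 (d₁ ⊔ (d₂ ⊔ d))
        NM≢0 : NonZero NM
        NM≢0 = N^≢0 (suc (d₁ ⊔ (d₂ ⊔ d)))
      up : ∀ {x} → x ≤ M → x ≤ NM
      up p = ≤-trans p (m≤n*m M N)
      x′ : cost l ρ ≤ M
      x′ = ≤^-left d₁ (d₂ ⊔ d) x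
      y′ : cost z ρ ≤ M
      y′ = ≤^-right d₁ (d₂ ⊔ d) (≤^-left d₂ d y)
      z′ : N ^ d ≤ M
      z′ = ≤^-right d₁ (d₂ ⊔ d) (≤^-right d₂ d ≤-refl)
      lemma₁ : ∀ N M → (N + N) * (14 * M) ≡ 28 * (N * M)
      lemma₁ = solve-∀
      lemma : ∀ x → 17 * x + (((3 * x + x) + ((3 * x + x) + 2 * x)) + 28 * x) ≡ 55 * x
      lemma = solve-∀

  nat-list : ∀ n → nat n ≡ encodeList (λ _ → leaf) (replicate n tt)
  nat-list zero    = refl
  nat-list (suc n) = cong (node leaf) (nat-list n)

  -- A unary number is a list of leaves; bounding the length of the suffix gives the step access to
  -- i < n.
  rFoldNat : ∀ (g : ℕ → Tree) {s ρ d l z n d₁ d₂} → n ≤ N →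
    (∀ i → i < n → Runs s (node leaf (node (g i) ρ)) (g (suc i)) d) →
    Runs l ρ (nat n) d₁ → Runs z ρ (g 0) d₂ →
    Runs (fold l z s) ρ (g n) (2 + (d₁ ⊔ (d₂ ⊔ d)))
  rFoldNat g {n = n} n≤N step r₁ r₂ =
    rFold (λ xs → g (length xs)) (λ xs → length xs ≤ n) (≤-trans (n≤1+n _)) (λ _ ys p → step (length ys) p)
      (≤-trans (≤-reflexive (length-replicate n)) n≤N) (≤-reflexive (length-replicate n))
      (r₁ ▹ nat-list n) r₂
    ▹ cong g (length-replicate n)

  infixr 5 _∷_

  data RunsAll (ρ : Tree) : List Term → List Tree → ℕ → Set where
    []  : RunsAll ρ [] [] 1
    _∷_ : ∀ {a as v vs d e} → Runs a ρ v d → RunsAll ρ as vs e → RunsAll ρ (a ∷ as) (v ∷ vs) (suc (d ⊔ e))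

  rTuple : ∀ {ρ as vs d} → RunsAll ρ as vs d → Runs (tuple as) ρ ⟨ vs ⟩ d
  rTuple []       = rLeaf
  rTuple (r ∷ rs) = rNode r (rTuple rs)

  rInvoke : ∀ {f ρ as vs v d e} → RunsAll ρ as vs d → Runs f ⟨ vs ⟩ v e → Runs (invoke f as) ρ v (suc (d ⊔ e))
  rInvoke rs r = rApp (rTuple rs) r

  rIncr : ∀ {a ρ n d} → Runs a ρ (nat n) d → Runs (incr a) ρ (nat (suc n)) (suc (1 ⊔ d))
  rIncr r = rNode rLeaf r

  rTrue : ∀ {ρ} → Runs trueᵗ ρ (encodeBool true) 2
  rTrue = rNode rLeaf rLeaf

  rPred : ∀ {a ρ d} n → Runs a ρ (nat n) d → Runs (predᵗ a) ρ (nat (pred n)) (suc (d ⊔ 2))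
  rPred {d = d} zero    r = raise (s≤s (⊔-monoʳ-≤ d (n≤1+n 1))) (rCase-leaf r rLeaf)
  rPred         (suc n) r = rCase-node r (rVar 1)

  rIsPositive : ∀ {a ρ d} n → Runs a ρ (nat n) d → Runs (isPositive a) ρ (encodeBool (positive n)) (suc (d ⊔ 2))
  rIsPositive n r = rPositive n r rLeaf (λ _ → rTrue) ▹ lemma n
    where
    lemma : ∀ n → (if positive n then encodeBool true else leaf) ≡ encodeBool (positive n)
    lemma zero    = refl
    lemma (suc n) = refl

  rCount : ∀ {X : Set} {f : X → Tree} {p : X → Bool} {l t ρ xs d₁ d} →
    length xs ≤ N → Runs l ρ (encodeList f xs) d₁ →
    (∀ x acc → Runs t (node (f x) (node acc ρ)) (encodeBool (p x)) d) →
    Runs (countᵗ l t) ρ (nat (count p xs)) (2 + (d₁ ⊔ (1 ⊔ suc (d ⊔ 3))))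
  rCount {p = p} len r step = rFold (λ ys → nat (count p ys)) (λ _ → ⊤) (λ _ → tt)
    (λ x ys _ → rIf (p x) (step x _) (rVar 1) (rIncr (rVar 3)) ▹ sym (Bool.if-float nat (p x)))
    len tt r rLeaf

  rLength : ∀ {X : Set} {f : X → Tree} xs → length xs ≤ N →
    Runs lengthᵗ ⟨ encodeList f xs ∷ [] ⟩ (nat (length xs)) 5
  rLength xs len = rFold (nat ∘ length) (λ _ → ⊤) (λ _ → tt) (λ x ys _ → rIncr (rVar 1)) len tt (rVar 0) rLeaf

  -- Arithmetic on unary numbers.

  rMonus : ∀ a {b} → b ≤ N → Runs monus ⟨ nat a ∷ nat b ∷ [] ⟩ (nat (a ∸ b)) 5
  rMonus a b≤N = rFoldNat (λ i → nat (a ∸ i)) b≤N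
    (λ i _ → rPred (a ∸ i) (rVar 1) ▹ cong nat (pred[m∸n]≡m∸[1+n] a i)) (rVar 1) (rVar 0)

  rPlus : ∀ {a} b → a ≤ N → Runs plus ⟨ nat a ∷ nat b ∷ [] ⟩ (nat (a + b)) 5
  rPlus b a≤N = rFoldNat (λ i → nat (i + b)) a≤N (λ i _ → rIncr (rVar 1)) (rVar 0) (rVar 1)

  rTimes : ∀ {a b} → a ≤ N → b ≤ N → Runs times ⟨ nat a ∷ nat b ∷ [] ⟩ (nat (a * b)) 8
  rTimes {a} {b} a≤N b≤N = rFoldNat (λ i → nat (i * b)) a≤N
    (λ i _ → rInvoke (rVar 3 ∷ rVar 1 ∷ []) (rPlus (i * b) b≤N)) (rVar 0) rLeaf

  rMinimum : ∀ {a b} → a ≤ N → b ≤ N → Runs minimum ⟨ nat a ∷ nat b ∷ [] ⟩ (nat (a ⊓ b)) 9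
  rMinimum {a} {b} a≤N b≤N = rInvoke
    (rVar 0 ∷ rInvoke (rVar 0 ∷ rVar 1 ∷ []) (rMonus a b≤N) ∷ [])
    (rMonus a (≤-trans (m∸n≤m a b) a≤N)) ▹ cong nat (∸∸≡⊓ a b)

  rCapped : ∀ {a} b → a + (2 + a) ≤ N → size (encodeℕᵇ b) ≤ N →
    Runs capped ⟨ nat a ∷ encodeℕᵇ b ∷ [] ⟩ (nat (a ⊓ ℕᵇ.toℕ b)) 13
  rCapped {a} b room small =
    rFold {f = encodeBool} (λ bs → nat (a ⊓ bitsValue bs)) (λ _ → ⊤) (λ _ → tt) step
      (≤-trans (length≤size encodeBool (bits b)) (subst (λ t → size t ≤ N) (encode-bits b) small)) tt
      (rVar 1 ▹ encode-bits b) (rLeaf ▹ cong nat (sym (⊓-zeroʳ a)))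
    ▹ cong (λ v → nat (a ⊓ v)) (bitsValue-bits b)
    where
    a≤N : a ≤ N
    a≤N = ≤-trans (m≤m+n a _) room
    y≤N : ∀ v → a ⊓ v ≤ N
    y≤N v = ≤-trans (m⊓n≤m a v) a≤N
    s≤N : ∀ v → a ⊓ v + (2 + a ⊓ v) ≤ N
    s≤N v = ≤-trans (+-mono-≤ (m⊓n≤m a v) (+-monoʳ-≤ 2 (m⊓n≤m a v))) room
    even : ∀ v → v + (2 + v) ≡ 2 * suc v
    even = solve-∀
    odd : ∀ v → v + suc v ≡ suc (2 * v)
    odd = solve-∀
    step : ∀ h bs → ⊤ → Runs _ _ _ 11
    step false bs _ = weaken 11 (rCase-leaf (rVar 0)
      (rInvoke (rVar 2 ∷ rInvoke (rVar 1 ∷ rIncr (rIncr (rVar 1)) ∷ []) (rPlus _ (y≤N (bitsValue bs))) ∷ [])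
        (rMinimum a≤N (s≤N (bitsValue bs)))
       ▹ cong nat (trans (⊓-absorb a (bitsValue bs) (λ v → v + (2 + v)) (λ v → m≤m+n v _)) (cong (a ⊓_) (even (bitsValue bs))))))
    step true bs _ = weaken 11 (rCase-node (rVar 0)
      (rInvoke (rVar 4 ∷ rInvoke (rVar 3 ∷ rIncr (rVar 3) ∷ []) (rPlus _ (y≤N (bitsValue bs))) ∷ [])
        (rMinimum a≤N (≤-trans (+-monoʳ-≤ (a ⊓ bitsValue bs) (n≤1+n _)) (s≤N (bitsValue bs))))
       ▹ cong nat (trans (⊓-absorb a (bitsValue bs) (λ v → v + suc v) (λ v → m≤m+n v _)) (cong (a ⊓_) (odd (bitsValue bs))))))

  -- Running times of the parts of the dynamic program.

  module _ {m n : ℕ} (code-small : ∀ (c : Fin n) → 2 + size (encodeFin c) ≤ N)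
           (n-room : n + (2 + n) ≤ N) (m≤N : m ≤ N) (key-room : m * n + n ≤ N) where

    private
      n≤N : n ≤ N
      n≤N = ≤-trans (m≤m+n n _) n-room

      encodeSubset : List (Fin n) → Tree
      encodeSubset = encodeList encodeFin

      encodeProfile : Profile m n → Tree
      encodeProfile = encodeFamily (encodeMaybe encodeFin)

      C : Tree
      C = encodeSubset (allFin n)

      length-C : length (allFin n) ≤ N
      length-C = ≤-trans (≤-reflexive (length-tabulate id)) n≤N

      fin-small : ∀ c → size (encodeFin c) ≤ N
      fin-small c = ≤-trans (m≤n+m _ 2) (code-small c)

    rCountFin : ∀ {p : Fin n → Bool} {l t ρ d₁ d} → Runs l ρ C d₁ →
      (∀ c acc → Runs t (node (encodeFin c) (node acc ρ)) (encodeBool (p c)) d) →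
      Runs (countᵗ l t) ρ (nat (card p)) (2 + (d₁ ⊔ (1 ⊔ suc (d ⊔ 3))))
    rCountFin {p} r step = rCount length-C r step ▹ cong nat (count-tabulate p id)

    rMember : ∀ c {A} → length A ≤ N →
      Runs member ⟨ encodeFin c ∷ encodeSubset A ∷ [] ⟩ (encodeBool (mem A c)) 7
    rMember c {A} len = rFold (λ A → encodeBool (mem A c)) (λ _ → ⊤) (λ _ → tt)
      (λ h A _ → rIf (does (h ≟ c)) (rEq (fin-small h) (rVar 0) (rVar 2) ▹ cong encodeBool (treeEq-fin h c)) (rVar 1) rTrue
        ▹ sym (Bool.if-float encodeBool (does (h ≟ c))))
      len tt (rVar 1) rLeaf

    rWeight : ∀ (u : Profile m n) c →
      Runs weightᵗ ⟨ encodeFin c ∷ encodeProfile u ∷ [] ⟩ (nat (weight u c)) 20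
    rWeight u c = weaken 20 (rCount {p = λ v → votes u v c} (≤-trans (≤-reflexive (length-tabulate u)) m≤N) (rVar 1)
      (λ v acc → rEq (small v) (rVar 0) (rNode rLeaf (rVar 2)) ▹ cong encodeBool (same v))
      ▹ cong nat (count-tabulate (λ v → votes u v c) u))
      where
      -- A cast vote has a node and a leaf more than its candidate, whence the 2 in `code-small`.
      small : ∀ v → size (encodeMaybe encodeFin v) ≤ N
      small nothing  = ≤-trans (s≤s z≤n) 64≤N
      small (just d) = code-small d
      same : ∀ v → treeEq (encodeMaybe encodeFin v) (node leaf (encodeFin c)) ≡ votes u v c
      same nothing  = refl
      same (just d) = treeEq-fin d c

    weight≤m : ∀ (u : Profile m n) c → weight u c ≤ m
    weight≤m u c = card≤n (λ a → votes u (u a) c)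

    key≤N : ∀ (u : Profile m n) c → key u c ≤ N
    key≤N u c = ≤-trans (+-mono-≤ (*-monoˡ-≤ n (weight≤m u c)) (m∸n≤m n (toℕ c))) key-room

    rKey : ∀ (u : Profile m n) c →
      Runs keyᵗ ⟨ encodeFin c ∷ nat n ∷ encodeProfile u ∷ [] ⟩ (nat (key u c)) 30
    rKey u c = weaken 30 (rInvoke
      (rInvoke (rInvoke (rVar 0 ∷ rVar 2 ∷ []) (rWeight u c) ∷ rVar 1 ∷ []) (rTimes (≤-trans (weight≤m u c) m≤N) n≤N)
       ∷ rInvoke (rVar 1 ∷ (rInvoke (rVar 1 ∷ rVar 0 ∷ []) (rCapped _ n-room (fin-small c)) ▹ cong nat index) ∷ [])
           (rMonus n (≤-trans (<⇒≤ (toℕ<n c)) n≤N))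
       ∷ [])
      (rPlus (n ∸ toℕ c) (≤-trans (m≤m+n _ (n ∸ toℕ c)) (key≤N u c))))
      where
      -- Here `capped` serves to convert a binary index to unary; the cap n has no effect, as
      -- indices are below n.
      index : n ⊓ ℕᵇ.toℕ (ℕᵇ.fromℕ (toℕ c)) ≡ toℕ c
      index = trans (cong (n ⊓_) (toℕ-fromℕ (toℕ c))) (m≥n⇒m⊓n≡n (<⇒≤ (toℕ<n c)))

    rRank : ∀ (u : Profile m n) c →
      Runs rankᵗ ⟨ encodeFin c ∷ C ∷ nat n ∷ encodeProfile u ∷ [] ⟩ (nat (rank (key u) c)) 50
    rRank u c = weaken 50 (rCountFin (rVar 1) (λ d acc →
      rIsPositive (key u d ∸ key u c)
        (rInvoke (rInvoke (rVar 0 ∷ rVar 4 ∷ rVar 5 ∷ []) (rKey u d)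
                ∷ rInvoke (rVar 2 ∷ rVar 4 ∷ rVar 5 ∷ []) (rKey u c) ∷ [])
          (rMonus (key u d) (key≤N u c)))
      ▹ cong encodeBool (positive-∸ (key u d) (key u c))))

    rDist : ∀ {A B} → length A ≤ N → length B ≤ N →
      Runs distᵗ ⟨ encodeSubset A ∷ encodeSubset B ∷ C ∷ [] ⟩ (nat (dist (mem A) (mem B))) 30
    rDist {A} {B} lenA lenB = weaken 30 (rCountFin (rVar 2) (λ c acc →
      rIf (treeEq (encodeBool (mem A c)) (encodeBool (mem B c)))
        (rEq (bool-small (mem A c))
          (rInvoke (rVar 0 ∷ rVar 2 ∷ []) (rMember c lenA)) (rInvoke (rVar 0 ∷ rVar 3 ∷ []) (rMember c lenB)))
        rTrue rLeaf
      ▹ trans (negate (treeEq (encodeBool (mem A c)) (encodeBool (mem B c)))) (cong encodeBool (treeEq-bool (mem A c) (mem B c)))))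
      where
      bool-small : ∀ b → size (encodeBool b) ≤ N
      bool-small false = ≤-trans (s≤s z≤n) 64≤N
      bool-small true  = ≤-trans (s≤s (s≤s (s≤s z≤n))) 64≤N
      negate : ∀ b → (if b then leaf else encodeBool true) ≡ encodeBool (not b)
      negate false = refl
      negate true  = refl

    rScore : ∀ (u : Profile m n) {A} → length A ≤ N →
      Runs scoreᵗ ⟨ encodeSubset A ∷ encodeProfile u ∷ [] ⟩ (nat (score u (mem A))) 30
    rScore u {A} len = weaken 30 (rCount {p = maybe′ (mem A) false} (≤-trans (≤-reflexive (length-tabulate u)) m≤N) (rVar 1) hit
      ▹ cong nat (count-tabulate (maybe′ (mem A) false) u))
      where
      hit : ∀ v acc → Runs _ _ (encodeBool (maybe′ (mem A) false v)) 20
      hit nothing  acc = weaken 20 (rCase-leaf (rVar 0) rLeaf)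
      hit (just c) acc = weaken 20 (rCase-node (rVar 0) (rInvoke (rVar 1 ∷ rVar 4 ∷ []) (rMember c len)))

    rConsAll : ∀ c L base → length L ≤ N →
      Runs consAllᵗ ⟨ encodeFin c ∷ encodeList encodeSubset L ∷ encodeList encodeSubset base ∷ [] ⟩
        (encodeList encodeSubset (consAll c L base)) 10
    rConsAll c L base len = weaken 10 (rFold (λ L → encodeList encodeSubset (consAll c L base)) (λ _ → ⊤) (λ _ → tt)
      (λ A L _ → rNode (rNode (rVar 2) (rVar 0)) (rVar 1)) len tt (rVar 1) (rVar 2))

    module _ (k x ℓ W : ℕ) (k≤n : k ≤ n) (W-room : n + W ≤ N) (family-room : 2 ^ (W + W) ≤ N) where
      open Dynamic m n k x ℓ W

      private
        k≤N : k ≤ N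
        k≤N = ≤-trans k≤n n≤N
        short : ∀ {a} → a ≤ n → a ≤ N
        short p = ≤-trans p n≤N
        encodeEntry : Entry → Tree
        encodeEntry (t , B) = node (nat t) (encodeSubset B)

      rExtend : ∀ u c L → length L ≤ N →
        Runs extendᵗ ⟨ nat (rank (key u) c) ∷ encodeFin c ∷ encodeList encodeSubset L ∷ nat k ∷ nat W ∷ [] ⟩
          (encodeList encodeSubset (if Stage.low u c then consAll c L []
            else (if Stage.high u c then L else consAll c L L))) 20
      rExtend u c L len = weaken 20 (
        rPositive (k ∸ (r + W)) (rInvoke (rVar 3 ∷ rInvoke (rVar 0 ∷ rVar 4 ∷ []) (rPlus W r≤N) ∷ [])
              (rMonus k (≤-trans (+-monoˡ-≤ W r≤n) W-room)))
          (rPositive (suc r ∸ (k + W)) (rInvoke (rIncr (rVar 0) ∷ rInvoke (rVar 3 ∷ rVar 4 ∷ []) (rPlus W k≤N) ∷ [])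
              (rMonus (suc r) (≤-trans (+-monoˡ-≤ W k≤n) W-room)))
            (rInvoke (rVar 1 ∷ rVar 2 ∷ rVar 2 ∷ []) (rConsAll c L L len))
            (λ _ → rVar 4))
          (λ _ → rInvoke (rVar 3 ∷ rVar 4 ∷ rLeaf ∷ []) (rConsAll c L [] len))
        ▹ outcome (positive-∸ k (r + W)) (positive-∸ (suc r) (k + W)))
        where
        r = rank (key u) c
        r≤n : r ≤ n
        r≤n = card≤n (λ d → key u c <ᵇ key u d)
        r≤N : r ≤ N
        r≤N = ≤-trans r≤n n≤N
        outcome : ∀ {a a′ b b′} → a ≡ a′ → b ≡ b′ → ∀ {L₁ L₂ L₃} →
          (if a then encodeList encodeSubset L₁ else (if b then encodeList encodeSubset L₂ else encodeList encodeSubset L₃))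
          ≡ encodeList encodeSubset (if a′ then L₁ else (if b′ then L₂ else L₃))
        outcome {true}          refl refl = refl
        outcome {false} {b = true}  refl refl = refl
        outcome {false} {b = false} refl refl = refl

      rFamily : ∀ u →
        Runs familyᵗ ⟨ C ∷ nat n ∷ encodeProfile u ∷ nat k ∷ nat W ∷ [] ⟩
          (encodeList encodeSubset (Stage.family u (allFin n))) 70
      rFamily u = weaken 70 (rFold (λ cs → encodeList encodeSubset (Stage.family u cs))
        (λ cs → length (Stage.family u cs) ≤ N) (λ {c} {cs} → ≤-trans (Stage.family-grows u c cs))
        (λ c cs p → rInvoke
          (rInvoke (rVar 0 ∷ rVar 2 ∷ rVar 3 ∷ rVar 4 ∷ []) (rRank u c) ∷ rVar 0 ∷ rVar 1 ∷ rVar 5 ∷ rVar 6 ∷ [])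
          (rExtend u c (Stage.family u cs) (≤-trans (Stage.family-grows u c cs) p)))
        length-C (≤-trans (length-family≤ u) family-room) (rVar 0) (rNode rLeaf rLeaf))

      rFeasible : ∀ u {A} → length A ≤ n →
        Runs feasibleᵗ ⟨ encodeSubset A ∷ C ∷ encodeProfile u ∷ nat k ∷ nat x ∷ [] ⟩ (encodeBool (feasible u A)) 50
      rFeasible u {A} len = weaken 50 (
        rPositive (card (mem A) ∸ k)
          -- The cardinality is computed as the distance from the empty set, which `leaf` encodes.
          (rInvoke ((rInvoke (rVar 0 ∷ rLeaf ∷ rVar 1 ∷ []) (rDist {A} {[]} (short len) z≤n)
                     ▹ cong nat (card-cong λ c → Bool.xor-identityʳ (mem A c))) ∷ rVar 3 ∷ [])
            (rMonus (card (mem A)) k≤N))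
          (rPositive (x ∸ score u (mem A)) (rInvoke (rVar 4 ∷ rInvoke (rVar 0 ∷ rVar 2 ∷ []) (rScore u (short len)) ∷ [])
              (rMonus x (≤-trans (card≤n (λ a → maybe′ (mem A) false (u a))) m≤N)))
            rTrue (λ _ → rLeaf))
          (λ _ → rLeaf)
        ▹ outcome (positive (card (mem A) ∸ k)) (positive (x ∸ score u (mem A))))
        where
        outcome : ∀ a b → (if a then leaf else (if b then leaf else node leaf leaf))
          ≡ encodeBool (if a then false else (if b then false else true))
        outcome true  b     = refl
        outcome false true  = refl
        outcome false false = refl

      rFits : ∀ acc {A} → length acc ≤ N → All (λ e → length (proj₂ e) ≤ n) acc → length A ≤ n →
        Runs fitsᵗ ⟨ encodeSubset A ∷ C ∷ encodeList encodeEntry acc ∷ [] ⟩ (encodeBool (fits acc A)) 50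
      rFits acc {A} len shorts lenA = weaken 50 (rFold (λ acc → encodeBool (fits acc A))
        (All (λ e → length (proj₂ e) ≤ n)) All.tail
        (λ { (t , B) acc (lenB ∷ _) → rCase-node (rVar 0)
          (rPositive (t ∸ dist (mem A) (mem B))
             (rInvoke (rVar 0 ∷ rInvoke (rVar 4 ∷ rVar 1 ∷ rVar 5 ∷ []) (rDist (short lenA) (short lenB)) ∷ [])
             (rMonus t (≤-trans (card≤n (λ c → mem A c xor mem B c)) n≤N)))
             rTrue (λ _ → rVar 5)
           ▹ sym (Bool.if-float encodeBool (positive (t ∸ dist (mem A) (mem B))))) })
        len shorts (rVar 2) rLeaf)

      rSelect : ∀ u acc → length acc ≤ N → All (λ e → length (proj₂ e) ≤ n) acc →
        Runs selectᵗ ⟨ encodeProfile u ∷ encodeList encodeEntry acc ∷ C ∷ nat n ∷ nat k ∷ nat x ∷ nat ℓ ∷ nat W ∷ [] ⟩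
          (encodeList encodeEntry (select u acc (Stage.family u (allFin n)))) 90
      rSelect u acc len shorts = weaken 90 (rFold (λ F → encodeList encodeEntry (select u acc F))
        (All (λ A → length A ≤ n)) All.tail
        (λ { A F (lenA ∷ _) →
          rIf (feasible u A) (rInvoke (rVar 0 ∷ rVar 4 ∷ rVar 2 ∷ rVar 6 ∷ rVar 7 ∷ []) (rFeasible u lenA))
            (rVar 1)
            (rIf (fits acc A) (rInvoke (rVar 2 ∷ rVar 6 ∷ rVar 5 ∷ []) (rFits acc len shorts lenA))
              (rVar 3)
              (rNode (rNode (rVar 12) (rVar 4)) (rVar 5)))
          ▹ outcome A F (feasible u A) (fits acc A) })
        (≤-trans (length-family≤ u) family-room) (family-short u)
        (rInvoke (rVar 2 ∷ rVar 3 ∷ rVar 0 ∷ rVar 4 ∷ rVar 7 ∷ []) (rFamily u)) rLeaf)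
        where
        outcome : ∀ A F a b →
          (if a then (if b then node (encodeEntry (ℓ , A)) (encodeList encodeEntry (select u acc F))
                      else encodeList encodeEntry (select u acc F))
           else encodeList encodeEntry (select u acc F))
          ≡ encodeList encodeEntry (if a then (if b then (ℓ , A) ∷ select u acc F else select u acc F) else select u acc F)
        outcome A F true  true  = refl
        outcome A F true  false = refl
        outcome A F false _     = refl

      rEntries : ∀ us → length us ≤ N →
        Runs entriesᵗ ⟨ encodeList encodeProfile us ∷ C ∷ nat n ∷ nat k ∷ nat x ∷ nat ℓ ∷ nat W ∷ [] ⟩
          (encodeList encodeEntry (entries us)) 110
      rEntries us len = weaken 110 (rFold (λ us → encodeList encodeEntry (entries us)) (λ _ → ⊤) (λ _ → tt)
        (λ u us _ → rInvoke (rVar 0 ∷ rVar 1 ∷ rVar 3 ∷ rVar 4 ∷ rVar 5 ∷ rVar 6 ∷ rVar 7 ∷ rVar 8 ∷ [])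
          (rSelect u (entries us) (≤-trans (length-entries us) family-room) (entries-short us)))
        len tt (rVar 0) (rNode (rNode rLeaf rLeaf) rLeaf))

  rNonEmpty : ∀ {X : Set} {f : X → Tree} {a ρ d} xs → Runs a ρ (encodeList f xs) d →
    Runs (isPositive a) ρ (encodeBool (nonEmpty xs)) (suc (d ⊔ 2))
  rNonEmpty {d = d} []       r = raise (s≤s (⊔-monoʳ-≤ d (n≤1+n 1))) (rCase-leaf r rLeaf)
  rNonEmpty         (x ∷ xs) r = rCase-node r rTrue

  rNumeral : ∀ {ρ} k → Runs (numeral k) ρ (nat k) (suc k)
  rNumeral zero    = rLeaf
  rNumeral (suc k) = rIncr (rNumeral k)

  -- The whole program on an instance.

  module _ (J : Instance) where
    open Instance J renaming (agents to m; candidates to n)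

    private
      S ℓ′ : ℕ
      S  = ∥ J ∥
      ℓ′ = suc n ⊓ ℓ

    rMain : 64 * (S * S) ≤ N → 2 ^ (16 * ℓ) ≤ N → Runs main (encode J) (encodeBool (answer J)) 140
    rMain room power = weaken 140 (rInvoke
      (rVar 2 ∷ rVar 1
        ∷ (rInvoke (rVar 1 ∷ []) (rLength (allFin n) (≤-trans (≤-reflexive (length-tabulate id)) n≤N))
            ▹ cong nat (length-tabulate id))
        ∷ (rInvoke (rVar 0 ∷ []) (rLength (allFin m) (≤-trans (≤-reflexive (length-tabulate id)) m≤N))
            ▹ cong nat (length-tabulate id))
        ∷ rVar 3 ∷ rVar 4
        ∷ rCase-node (rCase-node (rCase-node (rCase-node (rCase-node rEnv
            (rVar 1)) (rVar 1)) (rVar 1)) (rVar 1)) (rVar 1)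
        ∷ [])
      (rInvoke (rVar 0 ∷ rVar 1 ∷ rVar 2
        ∷ cap k (rInvoke (rVar 2 ∷ rVar 4 ∷ []) (rCapped _ n-room (linear (inʳ _ (inʳ _ (inʳ _ (inˡ _ ≤-refl)))))))
        ∷ cap x (rInvoke (rIncr (rVar 3) ∷ rVar 5 ∷ [])
            (rCapped _ (double-room m<S) (linear (inʳ _ (inʳ _ (inʳ _ (inʳ _ (inˡ _ ≤-refl))))))))
        ∷ cap ℓ (rInvoke (rIncr (rVar 2) ∷ rVar 6 ∷ [])
            (rCapped _ (double-room n<S) (linear (inʳ _ (inʳ _ (inʳ _ (inʳ _ (inʳ _ ≤-refl))))))))
        ∷ [])
        (rNonEmpty (entries (tabulate profile))
          (rInvoke (rVar 0 ∷ rVar 1 ∷ rVar 2 ∷ rVar 3 ∷ rVar 4 ∷ rVar 5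
            ∷ rInvoke (rNumeral 8 ∷ rVar 5 ∷ []) (rTimes (within-const 8) (linear ℓ′≤S)) ∷ [])
            (rEntries code-small n-room m≤N key-room (n ⊓ k) (suc m ⊓ x) ℓ′ (8 * ℓ′) (m⊓n≤m n k)
              (within 9 (+-mono-≤ n≤S (*-monoʳ-≤ 8 ℓ′≤S)))
              (≤-trans (^-monoʳ-≤ 2 (≤-trans (≤-reflexive (sym (*-distribʳ-+ ℓ′ 8 8)))
                  (*-monoʳ-≤ 16 (m⊓n≤n (suc n) ℓ)))) power)
              (tabulate profile) (linear τ≤S))))))
      where
      open Capped J using (entries)
      inˡ : ∀ {a b} c → a ≤ b → a ≤ suc (b + c)
      inˡ c p = ≤-trans p (≤-trans (m≤m+n _ c) (n≤1+n _))
      inʳ : ∀ {a b} c → a ≤ b → a ≤ suc (c + b)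
      inʳ c p = ≤-trans p (≤-trans (m≤n+m _ c) (n≤1+n _))
      square : ∀ c → {True (c ≤? 64)} → ∀ {y} → y ≤ c * (S * S) → y ≤ N
      square c {c≤64} p = ≤-trans p (≤-trans (*-monoˡ-≤ (S * S) (toWitness c≤64)) room)
      within : ∀ c → {True (c ≤? 64)} → ∀ {y} → y ≤ c * S → y ≤ N
      within c {c≤64} p = square c {c≤64} (≤-trans p (*-monoʳ-≤ c (m≤m*n S S)))
      linear : ∀ {y} → y ≤ S → y ≤ N
      linear p = within 1 (≤-trans p (m≤m+n S 0))
      within-const : ∀ c → {True (c ≤? 64)} → c ≤ N
      within-const c {c≤64} = within c {c≤64} (m≤m*n c S)
      elements≤ : ∀ {X : Set} {o} (f : X → Tree) (g : Fin o → X) → suc o ≤ size (encodeFamily f g)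
      elements≤ {o = zero}  f g = ≤-refl
      elements≤ {o = suc o} f g = s≤s (≤-trans (elements≤ f (g ∘ suc)) (m≤n+m _ (size (f (g zero)))))
      element-size : ∀ {X : Set} {o} (f : X → Tree) (g : Fin o → X) i → size (f (g i)) ≤ size (encodeFamily f g)
      element-size f g zero    = inˡ _ ≤-refl
      element-size f g (suc i) = inʳ (size (f (g zero))) (element-size f (g ∘ suc) i)
      m<S : suc m ≤ S
      m<S = inˡ _ (elements≤ encodeFin (λ i → i))
      n<S : suc n ≤ S
      n<S = inʳ _ (inˡ _ (elements≤ encodeFin (λ i → i)))
      n≤S : n ≤ S
      n≤S = <⇒≤ n<S
      m≤N : m ≤ N
      m≤N = linear (<⇒≤ m<S)
      n≤N : n ≤ N
      n≤N = linear n≤S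
      τ≤S : length (tabulate profile) ≤ S
      τ≤S = ≤-trans (≤-reflexive (length-tabulate profile)) (<⇒≤ (inʳ (size (encodeSet m)) (inʳ (size (encodeSet n))
        (inˡ _ (elements≤ (encodeFamily (encodeMaybe encodeFin)) profile)))))
      ℓ′≤S : ℓ′ ≤ S
      ℓ′≤S = ≤-trans (m⊓n≤m (suc n) ℓ) n<S
      double-room : ∀ {y} → y ≤ S → y + (2 + y) ≤ N
      double-room {y} p = within 4 (≤-trans (+-mono-≤ p (+-mono-≤ (m≤m*n 2 S) p)) (≤-reflexive (lemma S)))
        where
        lemma : ∀ s → s + (2 * s + s) ≡ 4 * s
        lemma = solve-∀
      n-room : n + (2 + n) ≤ N
      n-room = double-room n≤S
      key-room : m * n + n ≤ N
      -- Keys are held in unary and can reach mn + n. This is the bound that calls for the square of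
      -- the input size in N.
      key-room = square 2 (+-mono-≤ (*-mono-≤ (<⇒≤ m<S) n≤S) (≤-trans n≤S (≤-trans (m≤m*n S S) (m≤m+n (S * S) 0))))
      code-small : ∀ (c : Fin n) → 2 + size (encodeFin c) ≤ N
      code-small c = within 3 (≤-trans (+-mono-≤ (m≤m*n 2 S)
          (inʳ (size (encodeSet m)) (inˡ _ (element-size encodeFin (λ i → i) c))))
        (≤-reflexive (lemma S)))
        where
        lemma : ∀ s → 2 * s + s ≡ 3 * s
        lemma = solve-∀
      cap : ∀ {e ρ a d} v → Runs e ρ (nat (a ⊓ ℕᵇ.toℕ (ℕᵇ.fromℕ v))) d → Runs e ρ (nat (a ⊓ v)) d
      cap {a = a} v r = r ▹ cong (λ w → nat (a ⊓ w)) (toℕ-fromℕ v)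

-- The final bound.

^-distribˡ-* : ∀ x y e → (x * y) ^ e ≡ x ^ e * y ^ e
^-distribˡ-* x y zero    = refl
^-distribˡ-* x y (suc e) = trans (cong (x * y *_) (^-distribˡ-* x y e)) (interchange x y (x ^ e) (y ^ e))
  where
  interchange : ∀ a b c d → a * b * (c * d) ≡ a * c * (b * d)
  interchange = solve-∀

n<2^n : ∀ n → n < 2 ^ n
n<2^n zero    = s≤s z≤n
n<2^n (suc n) = +-mono-≤ (m^n>0 2 n) (≤-trans (n<2^n n) (m≤m+n _ 0))

module _ (ℓ s l d c : ℕ) where

  private
    N M e : ℕ
    N = 2 ^ (16 * ℓ) * (s * s)
    M = N ^ (l ⊔ d)
    e = suc (l ⊔ d)

  -- The cost l of writing down the program code is independent of the instance but need not be
  -- below N; since l < 2^l ≤ N^l, it goes into the exponent. That exponent depends on the program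
  -- only, and N^e splits into the exponential factor in ℓ and the polynomial one in s.
  runningTime : 64 ≤ N → c ≤ N ^ d → suc ((l + 1) + c) ≤ 2 ^ (16 * e * ℓ) * s ^ (2 * e)
  runningTime 64≤N c≤ = begin
    suc ((l + 1) + c)                 ≡⟨ rearrange l c ⟩
    2 + (l + c)                       ≤⟨ +-mono-≤ (m≤m*n 2 M) (+-mono-≤ l≤M (≤-trans c≤ (^-monoʳ-≤ N (m≤n⊔m l d)))) ⟩
    2 * M + (M + M)                   ≡⟨ collect M ⟩
    4 * M                             ≤⟨ *-monoˡ-≤ M (≤-trans (toWitness {a? = 4 ≤? 64} _) 64≤N) ⟩
    N ^ e                             ≡⟨ ^-distribˡ-* (2 ^ (16 * ℓ)) (s * s) e ⟩
    (2 ^ (16 * ℓ)) ^ e * (s * s) ^ e  ≡⟨ cong₂ _*_ (trans (^-*-assoc 2 (16 * ℓ) e) (cong (2 ^_) (commute 16 ℓ e)))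
                                           (trans (cong (λ w → (s * w) ^ e) (sym (*-identityʳ s))) (^-*-assoc s 2 e)) ⟩
    2 ^ (16 * e * ℓ) * s ^ (2 * e)    ∎
    where
    open ≤-Reasoning
    instance
      N≢0 : NonZero N
      N≢0 = >-nonZero (≤-trans (s≤s z≤n) 64≤N)
      M≢0 : NonZero M
      M≢0 = m^n≢0 N (l ⊔ d)
    l≤M : l ≤ M
    l≤M = ≤-trans (<⇒≤ (n<2^n l)) (≤-trans (^-monoˡ-≤ l (≤-trans (s≤s (s≤s z≤n)) 64≤N)) (^-monoʳ-≤ N (m≤m⊔n l d)))
    rearrange : ∀ l c → suc ((l + 1) + c) ≡ 2 + (l + c)
    rearrange = solve-∀
    collect : ∀ M → 2 * M + (M + M) ≡ 4 * M
    collect = solve-∀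
    commute : ∀ a ℓ e → a * ℓ * e ≡ a * e * ℓ
    commute = solve-∀

base : Instance → ℕ
base J = 2 ^ (16 * Instance.ℓ J) * (∥ J ∥ * ∥ J ∥)

64*≤base : ∀ J → 64 * (∥ J ∥ * ∥ J ∥) ≤ base J
-- 64 is 2^6, and 6 ≤ 16ℓ because ℓ is positive.
64*≤base J = *-monoˡ-≤ (∥ J ∥ * ∥ J ∥) (^-monoʳ-≤ 2 {6} {16 * ℓ} (≤-trans (toWitness {a? = 6 ≤? 16} _) (m≤m*n 16 ℓ)))
  where open Instance J

64≤base : ∀ J → 64 ≤ base J
64≤base J = ≤-trans (m≤m*n 64 (∥ J ∥ * ∥ J ∥)) (64*≤base J)

solvable : (p : Term) (d : ℕ) (answer : Instance → Bool) →
  ((J : Instance) → Reflects (HasSolution J) (answer J)) →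
  ((J : Instance) → Timing.Runs (base J) (64≤base J) p (encode J) (encodeBool (answer J)) d) →
  Σ[ P ∈ Program ] Σ[ a ∈ ℕ ] Σ[ b ∈ ℕ ]
    ((J : Instance) →
    Σ[ answer ∈ Bool ] Σ[ t ∈ ℕ ]
    Reflects (HasSolution J) answer ×
    (P on encode J outputs encodeBool answer inTime t) ×
    t ≤ 2 ^ (a * Instance.ℓ J) * ∥ J ∥ ^ b)
solvable p d answer correct timing = interpret p , 16 * suc (l ⊔ d) , 2 * suc (l ⊔ d) , λ J →
  answer J , suc ((l + 1) + cost p (encode J)) , correct J ,
  -- The arguments of the outermost call cost l for the code literal and 1 for the input.
  call (literal-correct p (code p) ∷ var zero ∷ [])
    (subst (λ v → Semantics._⊢_⇓_⟨_⟩ (interpret p) (code p ∷ encode J ∷ []) (interpreterBody RUN) v (cost p (encode J)))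
      (Timing.Runs.value (timing J)) (run-correct p p (encode J))) ,
  runningTime (Instance.ℓ J) ∥ J ∥ l d (cost p (encode J)) (64≤base J) (Timing.Runs.bound (timing J))
  where
  open Semantics (interpret p)
  l : ℕ
  l = literalCost (code p)

theorem12 : Σ[ P ∈ Program ] Σ[ a ∈ ℕ ] Σ[ b ∈ ℕ ]
    ((J : Instance) →
    Σ[ answer ∈ Bool ] Σ[ t ∈ ℕ ]
    Reflects (HasSolution J) answer ×
    (P on encode J outputs encodeBool answer inTime t) ×
    t ≤ 2 ^ (a * Instance.ℓ J) * ∥ J ∥ ^ b)
theorem12 = solvable main 140 answer answer-correct λ J →
  Timing.rMain (base J) (64≤base J) J (64*≤base J) (m≤m*n (2 ^ (16 * Instance.ℓ J)) (∥ J ∥ * ∥ J ∥))
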